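{- Let $p$ be a prime number and let $A$ be a zero-sum free subset of $\mathbb{Z}/p\mathbb{Z}$ of maximal cardinality (among all zero-sum free subsets of $\mathbb{Z}/p\mathbb{Z}$). Then $|A|$ is the greatest integer $k$ such that $\frac{k(k+1)}{2}<p$.
   Context: For $A\subset\mathbb{Z}/p\mathbb{Z}$, $\Sigma^*(A)=\{\sum_{x\in I}x : \emptyset\neq I\subset A\}$. A subset $A$ is zero-sum free if $0\notin\Sigma^*(A)$. -}

module Defs where

open import Data.Nat using (ℕ; zero; suc; _+_; _%_; NonZero)
open import Data.Fin using (Fin; toℕ)
open import Data.Fin.Subset using (Subset; _⊆_; Nonempty; outside; inside)
open import Data.Vec using (Vec; []; _∷_; tabulate)
open import Data.Product using (Σ; _×_)
open import Relation.Nullary using (¬_)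
open import Relation.Binary.PropositionalEquality using (_≡_)

-- ℤ/pℤ is modelled as Fin p (residues 0..p-1); a subset is a Data.Fin.Subset p.

sumℕ : ∀ {n} → Subset n → ℕ
sumℕ {n} I = go I (tabulate toℕ)
  where
  go : ∀ {m} → Subset m → Vec ℕ m → ℕ
  go [] [] = 0
  go (outside ∷ s) (_ ∷ v) = go s v
  go (inside ∷ s) (x ∷ v) = x + go s v

subsetSum : ∀ {p} .{{_ : NonZero p}} → Subset p → ℕ
subsetSum {p} I = sumℕ I % p

_∈Σ*_ : ∀ {p} .{{_ : NonZero p}} → ℕ → Subset p → Set
_∈Σ*_ {p} s A = Σ (Subset p) λ I → I ⊆ A × Nonempty I × subsetSum I ≡ s

ZeroSumFree : ∀ {p} .{{_ : NonZero p}} → Subset p → Set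
ZeroSumFree A = ¬ (0 ∈Σ* A)

{-# OPTIONS --safe #-}
module Submission where

-- If 1 + ⋯ + k < p then {1, …, k} is zero-sum free, so only the upper bound is
-- hard.  Let a₁, …, a_d be a zero-sum free list with d(d−1)/2 < p ≤ d(d+1)/2 and
-- σ = Σ aᵢ.  For signs ε put xᵢ = εᵢaᵢ; then Σ xᵢ + σ is twice a subset sum, so
-- f(x) = ∏_{0<j<p} (Σ xᵢ + σ − j) vanishes mod p unless all signs are negative.
-- Let s = d(d+1)/2 − (p − 1), let Δ(x) be the Vandermonde determinant and Δₛ(x)
-- the one with exponents {0, …, d} ∖ {d − s}.  The combination
-- Δ(−a) Δₛ(x) − Δₛ(−a) Δ(x) vanishes when all signs are negative, so p divides
--   Σ_ε (∏ εᵢ) f(x) (Δ(−a) Δₛ(x) − Δₛ(−a) Δ(x)).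
-- Summing against ∏ εᵢ keeps the monomials that are odd in every variable, and an
-- alternating polynomial has none of degree below 1 + 3 + ⋯ + (2d−1) = d².  Hence
-- only the leading form (Σ xᵢ)^(p−1) Δₛ(x) contributes, and by Pieri's rule
-- the sum is Δ(−a) ∏ 2aᵢ Δ(a²) (p−1)! det(ρᵢ^(k falling)) / ∏ ρᵢ! with ρ the odd
-- numbers below 2d and k ∈ {0, …, d} ∖ {d − s}.  Column operations evaluate the
-- last determinant: it is Δ(ρ) (d+s)! / (2ˢ s! (d−s)!).  The elements ±aᵢ are
-- distinct and nonzero mod p, so 2d < p and no factor is divisible by p.

-- Determinants by Laplace expansion, and Pieri's rule.

module Determinants where

  open import Data.Integer using (ℤ; 0ℤ; 1ℤ; -1ℤ; _+_; _*_; _-_; -_)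
  open import Data.Integer.Properties using (*-identityˡ; *-zeroʳ)
  open import Data.Integer.Tactic.RingSolver using (solve-∀)
  open import Data.List using (List; []; _∷_; map)
  open import Data.List.Membership.Propositional using (_∈_)
  open import Data.List.Relation.Unary.Any using (here; there)
  open import Data.Nat using (ℕ; suc)
  open import Data.Sum using (_⊎_; inj₁; inj₂)
  open import Function using (_∘_)
  open import Relation.Binary.PropositionalEquality
  open ≡-Reasoning

  private variable
    C C′ X X′ : Set

  -- The minors are an arbitrary function `G` of the remaining columns, and a skipped column is put
  -- back in front of its argument. With `G` abstract, sums over signs, `∂` and column operations
  -- pass through the expansion by induction on the columns.
  laplace : (C → ℤ) → (List C → ℤ) → List C → ℤ
  laplace w G []       = 0ℤ
  laplace w G (c ∷ cs) = w c * G cs - laplace w (G ∘ (c ∷_)) cs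

  -- The value is 0 when the numbers of rows and columns differ.
  det : (X → C → ℤ) → List X → List C → ℤ
  det e []       []      = 1ℤ
  det e []       (_ ∷ _) = 0ℤ
  det e (x ∷ xs) cs      = laplace (e x) (det e xs) cs

  data Pick {C : Set} : List C → C → List C → Set where
    here  : ∀ {c cs} → Pick (c ∷ cs) c cs
    there : ∀ {b c cs ds} → Pick cs c ds → Pick (b ∷ cs) c (b ∷ ds)

  -- Adjacent repetitions suffice: raising one entry of a strictly decreasing list, or adding a
  -- column to its neighbour, produces no others.
  data Repeat {C : Set} : List C → Set where
    here  : ∀ {c cs} → Repeat (c ∷ c ∷ cs)
    there : ∀ {c cs} → Repeat cs → Repeat (c ∷ cs)

  laplace-cong : ∀ {w v : C → ℤ} {G H} → (∀ c → w c ≡ v c) → (∀ cs → G cs ≡ H cs) →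
                 ∀ cs → laplace w G cs ≡ laplace v H cs
  laplace-cong p q []       = refl
  laplace-cong p q (c ∷ cs) =
    cong₂ _-_ (cong₂ _*_ (p c) (q cs)) (laplace-cong p (q ∘ (c ∷_)) cs)

  laplace-linear : ∀ (w : C → ℤ) a b G H cs →
    laplace w (λ ds → a * G ds + b * H ds) cs ≡ a * laplace w G cs + b * laplace w H cs
  laplace-linear w a b G H [] = ring a b
    where
    ring : ∀ a b → 0ℤ ≡ a * 0ℤ + b * 0ℤ
    ring = solve-∀
  laplace-linear w a b G H (c ∷ cs)
    rewrite laplace-linear w a b (G ∘ (c ∷_)) (H ∘ (c ∷_)) cs =
    ring a b (w c) (G cs) (H cs) (laplace w (G ∘ (c ∷_)) cs) (laplace w (H ∘ (c ∷_)) cs)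
    where
    ring : ∀ a b w g h g′ h′ → w * (a * g + b * h) - (a * g′ + b * h′)
           ≡ a * (w * g - g′) + b * (w * h - h′)
    ring = solve-∀

  laplace-linearʷ : ∀ (w v : C → ℤ) a b G cs →
    laplace (λ c → a * w c + b * v c) G cs ≡ a * laplace w G cs + b * laplace v G cs
  laplace-linearʷ w v a b G [] = ring a b
    where
    ring : ∀ a b → 0ℤ ≡ a * 0ℤ + b * 0ℤ
    ring = solve-∀
  laplace-linearʷ w v a b G (c ∷ cs)
    rewrite laplace-linearʷ w v a b (G ∘ (c ∷_)) cs =
    ring a b (w c) (v c) (G cs) (laplace w (G ∘ (c ∷_)) cs) (laplace v (G ∘ (c ∷_)) cs)
    where
    ring : ∀ a b w v g g′ h′ → (a * w + b * v) * g - (a * g′ + b * h′)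
           ≡ a * (w * g - g′) + b * (v * g - h′)
    ring = solve-∀

  laplace-scaleʷ : ∀ a (w : C → ℤ) G cs → laplace (λ c → a * w c) G cs ≡ a * laplace w G cs
  laplace-scaleʷ a w G []       = sym (*-zeroʳ a)
  laplace-scaleʷ a w G (c ∷ cs) rewrite laplace-scaleʷ a w (G ∘ (c ∷_)) cs =
    ring a (w c) (G cs) (laplace w (G ∘ (c ∷_)) cs)
    where
    ring : ∀ a w g g′ → a * w * g - a * g′ ≡ a * (w * g - g′)
    ring = solve-∀

  laplace-scale : ∀ a (w : C → ℤ) G cs → laplace w (λ ds → a * G ds) cs ≡ a * laplace w G cs
  laplace-scale a w G []       = sym (*-zeroʳ a)
  laplace-scale a w G (c ∷ cs) rewrite laplace-scale a w (G ∘ (c ∷_)) cs =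
    ring a (w c) (G cs) (laplace w (G ∘ (c ∷_)) cs)
    where
    ring : ∀ a w g g′ → w * (a * g) - a * g′ ≡ a * (w * g - g′)
    ring = solve-∀

  laplace-map : ∀ (f : C → C′) w G cs → laplace w G (map f cs) ≡ laplace (w ∘ f) (G ∘ map f) cs
  laplace-map f w G []       = refl
  laplace-map f w G (c ∷ cs) = cong (_-_ (w (f c) * G (map f cs))) (laplace-map f w (G ∘ (f c ∷_)) cs)

  laplace-zero : ∀ (w : C → ℤ) G cs → (∀ {c ds} → Pick cs c ds → w c * G ds ≡ 0ℤ) →
                 laplace w G cs ≡ 0ℤ
  laplace-zero w G []       z = refl
  laplace-zero w G (c ∷ cs) z = cong₂ _-_ (z here) (laplace-zero w (G ∘ (c ∷_)) cs (z ∘ there))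

  -- The two terms that pick one of the equal columns have the same minor and opposite signs; all
  -- other minors keep the repetition.
  laplace-repeat : ∀ (w : C → ℤ) G → (∀ {cs} → Repeat cs → G cs ≡ 0ℤ) →
                   ∀ {cs} → Repeat cs → laplace w G cs ≡ 0ℤ
  laplace-repeat w G z {c ∷ _ ∷ cs} here =
    trans (ring (w c * G (c ∷ cs)) _)
          (laplace-zero w (λ ds → G (c ∷ c ∷ ds)) cs (λ {b} _ → trans (cong (w b *_) (z here)) (*-zeroʳ (w b))))
    where
    ring : ∀ a b → a - (a - b) ≡ b
    ring = solve-∀
  laplace-repeat w G z {c ∷ cs} (there r) =
    cong₂ _-_ (trans (cong (w c *_) (z r)) (*-zeroʳ (w c))) (laplace-repeat w (G ∘ (c ∷_)) (λ s → z (there s)) r)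

  det-repeat : ∀ (e : X → C → ℤ) xs {cs} → Repeat cs → det e xs cs ≡ 0ℤ
  det-repeat e []       here      = refl
  det-repeat e []       (there r) = refl
  det-repeat e (x ∷ xs) r         = laplace-repeat (e x) (det e xs) (det-repeat e xs) r

  pick-∈ : ∀ {b c : C} {cs ds} → Pick cs b ds → c ∈ cs → c ≡ b ⊎ c ∈ ds
  pick-∈ here      (here c≡b)   = inj₁ c≡b
  pick-∈ here      (there c∈cs) = inj₂ c∈cs
  pick-∈ (there p) (here c≡a)   = inj₂ (here c≡a)
  pick-∈ (there p) (there c∈cs) with pick-∈ p c∈cs
  ... | inj₁ c≡b  = inj₁ c≡b
  ... | inj₂ c∈ds = inj₂ (there c∈ds)

  det-zeroColumn : ∀ (e : X → C → ℤ) xs {c cs} → c ∈ cs → (∀ x → e x c ≡ 0ℤ) → det e xs cs ≡ 0ℤ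
  det-zeroColumn e []       (here _)  z = refl
  det-zeroColumn e []       (there _) z = refl
  det-zeroColumn e (x ∷ xs) {c} {cs} c∈cs z = laplace-zero (e x) (det e xs) cs vanish
    where
    vanish : ∀ {b ds} → Pick cs b ds → e x b * det e xs ds ≡ 0ℤ
    vanish {b} {ds} p with pick-∈ p c∈cs
    ... | inj₁ refl = cong (_* det e xs ds) (z x)
    ... | inj₂ c∈ds = trans (cong (e x b *_) (det-zeroColumn e xs c∈ds z)) (*-zeroʳ (e x b))

  product-of : (X → ℤ) → List X → ℤ
  product-of g []       = 1ℤ
  product-of g (x ∷ xs) = g x * product-of g xs

  -- Relabelling and scaling are combined so that one lemma serves the odd columns (factor 2a, rows
  -- a²), the factor `v x - v y` of an elimination step, and the passage from exponents to column
  -- functions.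
  det-scaleRows : ∀ (e : X → C → ℤ) (e′ : X′ → C′ → ℤ) (g : X → ℤ) (h : X → X′) (f : C′ → C) →
    (∀ x c → e x (f c) ≡ g x * e′ (h x) c) →
    ∀ xs cs → det e xs (map f cs) ≡ product-of g xs * det e′ (map h xs) cs
  det-scaleRows e e′ g h f eq []       []       = refl
  det-scaleRows e e′ g h f eq []       (c ∷ cs) = refl
  det-scaleRows e e′ g h f eq (x ∷ xs) cs = begin
    laplace (e x) (det e xs) (map f cs)
      ≡⟨ laplace-map f (e x) (det e xs) cs ⟩
    laplace (e x ∘ f) (det e xs ∘ map f) cs
      ≡⟨ laplace-cong (eq x) (det-scaleRows e e′ g h f eq xs) cs ⟩
    laplace (λ c → g x * e′ (h x) c) (λ ds → P * D ds) cs
      ≡⟨ laplace-scaleʷ (g x) (e′ (h x)) _ cs ⟩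
    g x * laplace (e′ (h x)) (λ ds → P * D ds) cs
      ≡⟨ cong (g x *_) (laplace-scale P (e′ (h x)) D cs) ⟩
    g x * (P * laplace (e′ (h x)) D cs)
      ≡⟨ ring (g x) P _ ⟩
    g x * P * laplace (e′ (h x)) D cs ∎
    where
    P = product-of g xs
    D = det e′ (map h xs)
    ring : ∀ a b c → a * (b * c) ≡ a * b * c
    ring = solve-∀

  -- The box-adding operator of Pieri's rule. On alternants it acts as multiplication by the sum of
  -- the variables, up to a constant that depends on the exponents.
  ∂ : (List ℕ → ℤ) → List ℕ → ℤ
  ∂ G []      = 0ℤ
  ∂ G (k ∷ K) = G (suc k ∷ K) + ∂ (G ∘ (k ∷_)) K

  ∂-scale : ∀ a G K → ∂ (λ L → a * G L) K ≡ a * ∂ G K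
  ∂-scale a G []      = sym (*-zeroʳ a)
  ∂-scale a G (k ∷ K) rewrite ∂-scale a (G ∘ (k ∷_)) K = ring a (G (suc k ∷ K)) (∂ (G ∘ (k ∷_)) K)
    where
    ring : ∀ a b c → a * b + a * c ≡ a * (b + c)
    ring = solve-∀

  ∂-minus : ∀ G H K → ∂ (λ L → G L - H L) K ≡ ∂ G K - ∂ H K
  ∂-minus G H []      = refl
  ∂-minus G H (k ∷ K) rewrite ∂-minus (G ∘ (k ∷_)) (H ∘ (k ∷_)) K =
    ring (G (suc k ∷ K)) (H (suc k ∷ K)) (∂ (G ∘ (k ∷_)) K) (∂ (H ∘ (k ∷_)) K)
    where
    ring : ∀ a b c d → a - b + (c - d) ≡ a + c - (b + d)
    ring = solve-∀

  -- A Leibniz rule: the raised exponent lies in the minor or is the one picked by the row.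
  ∂-laplace : ∀ w G K → ∂ (laplace w G) K ≡ laplace w (∂ G) K + laplace (w ∘ suc) G K
  ∂-laplace w G []      = refl
  ∂-laplace w G (k ∷ K) = begin
    a - A + ∂ (λ L → w k * G L - laplace w (G ∘ (k ∷_)) L) K
      ≡⟨ cong (a - A +_) (trans (∂-minus (λ L → w k * G L) (laplace w (G ∘ (k ∷_))) K)
           (cong₂ _-_ (∂-scale (w k) G K) (∂-laplace w (G ∘ (k ∷_)) K))) ⟩
    a - A + (c - (B + D))
      ≡⟨ ring a A c B D ⟩
    c - (1ℤ * A + 1ℤ * B) + (a - D)
      ≡⟨ cong (λ z → c - z + (a - D)) (sym (laplace-linear w 1ℤ 1ℤ (G ∘ (suc k ∷_)) (∂ (G ∘ (k ∷_))) K)) ⟩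
    c - laplace w (λ L → 1ℤ * G (suc k ∷ L) + 1ℤ * ∂ (G ∘ (k ∷_)) L) K + (a - D)
      ≡⟨ cong (λ z → c - z + (a - D)) (laplace-cong {w = w} (λ _ → refl)
           (λ L → cong₂ _+_ (*-identityˡ (G (suc k ∷ L))) (*-identityˡ (∂ (G ∘ (k ∷_)) L))) K) ⟩
    c - laplace w (∂ G ∘ (k ∷_)) K + (a - D) ∎
    where
    a = w (suc k) * G K
    c = w k * ∂ G K
    A = laplace w (G ∘ (suc k ∷_)) K
    B = laplace w (∂ (G ∘ (k ∷_))) K
    D = laplace (w ∘ suc) (G ∘ (k ∷_)) K
    ring : ∀ a b c d e → a - b + (c - (d + e)) ≡ c - (1ℤ * b + 1ℤ * d) + (a - e)
    ring = solve-∀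

  sum-of : (X → ℤ) → List X → ℤ
  sum-of g []       = 0ℤ
  sum-of g (x ∷ xs) = g x + sum-of g xs

  -- In each term the picked column and the minor share out the columns, so their weights add up to
  -- the fixed total.
  laplace-weight : ∀ (μ w : C → ℤ) G cs →
    laplace w (λ ds → sum-of μ ds * G ds) cs + laplace (λ c → μ c * w c) G cs
      ≡ sum-of μ cs * laplace w G cs
  laplace-weight μ w G []       = refl
  laplace-weight μ w G (c ∷ cs) = begin
    w c * (sum-of μ cs * G cs) - laplace w (λ ds → (μ c + sum-of μ ds) * G (c ∷ ds)) cs
      + (μ c * w c * G cs - R)
      ≡⟨ cong (λ z → w c * (sum-of μ cs * G cs) - z + (μ c * w c * G cs - R)) (trans
           (laplace-cong {w = w} (λ _ → refl) (λ ds → split (μ c) (sum-of μ ds) (G (c ∷ ds))) cs)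
           (laplace-linear w (μ c) 1ℤ (G ∘ (c ∷_)) (λ ds → sum-of μ ds * G (c ∷ ds)) cs)) ⟩
    w c * (sum-of μ cs * G cs) - (μ c * L + 1ℤ * Q) + (μ c * w c * G cs - R)
      ≡⟨ ring₁ (w c) (sum-of μ cs) (G cs) (μ c) L Q R ⟩
    (μ c + sum-of μ cs) * (w c * G cs) - (μ c * L + (Q + R))
      ≡⟨ cong (λ z → (μ c + sum-of μ cs) * (w c * G cs) - (μ c * L + z)) (laplace-weight μ w (G ∘ (c ∷_)) cs) ⟩
    (μ c + sum-of μ cs) * (w c * G cs) - (μ c * L + sum-of μ cs * L)
      ≡⟨ ring₂ (μ c) (sum-of μ cs) (w c * G cs) L ⟩
    (μ c + sum-of μ cs) * (w c * G cs - L) ∎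
    where
    L = laplace w (G ∘ (c ∷_)) cs
    Q = laplace w (λ ds → sum-of μ ds * G (c ∷ ds)) cs
    R = laplace (λ c → μ c * w c) (G ∘ (c ∷_)) cs
    split : ∀ a b g → (a + b) * g ≡ a * g + 1ℤ * (b * g)
    split = solve-∀
    ring₁ : ∀ w s g m l q r → w * (s * g) - (m * l + 1ℤ * q) + (m * w * g - r) ≡ (m + s) * (w * g) - (m * l + (q + r))
    ring₁ = solve-∀
    ring₂ : ∀ m s g l → (m + s) * g - (m * l + s * l) ≡ (m + s) * (g - l)
    ring₂ = solve-∀

  ∂-zero : ∀ K → ∂ (λ _ → 0ℤ) K ≡ 0ℤ
  ∂-zero []      = refl
  ∂-zero (k ∷ K) = cong (0ℤ +_) (∂-zero K)

  -- Pieri's rule for alternants in a Newton basis.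
  ∂-det : ∀ (v : X → ℤ) (μ : ℕ → ℤ) (e : X → ℕ → ℤ) →
    (∀ x k → e x (suc k) ≡ (v x - μ k) * e x k) →
    ∀ xs K → ∂ (det e xs) K ≡ (sum-of v xs - sum-of μ K) * det e xs K
  ∂-det v μ e eq []       []      = refl
  ∂-det v μ e eq []       (k ∷ K) = trans (cong (0ℤ +_) (∂-zero K)) (sym (*-zeroʳ (0ℤ - sum-of μ (k ∷ K))))
  ∂-det v μ e eq (x ∷ xs) K       = begin
    ∂ (laplace (e x) D) K
      ≡⟨ ∂-laplace (e x) D K ⟩
    laplace (e x) (∂ D) K + laplace (e x ∘ suc) D K
      -- Row `x` contributes `v x - μ k` at the column `k` that it picks, and the induction
      -- hypothesis contributes `V - sum-of μ L` for the minor on `L`.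
      ≡⟨ cong₂ _+_
           (trans (laplace-cong {w = e x} (λ _ → refl) (λ L → trans (∂-det v μ e eq xs L) (ring₁ V (sum-of μ L) (D L))) K)
                  (laplace-linear (e x) V -1ℤ D (λ L → sum-of μ L * D L) K))
           (trans (laplace-cong {G = D} (λ k → trans (eq x k) (ring₁ (v x) (μ k) (e x k))) (λ _ → refl) K)
                  (laplace-linearʷ (e x) (λ k → μ k * e x k) (v x) -1ℤ D K)) ⟩
    (V * laplace (e x) D K + -1ℤ * A) + (v x * laplace (e x) D K + -1ℤ * B)
      ≡⟨ ring₂ V (v x) _ A B ⟩
    (v x + V) * laplace (e x) D K - (A + B)
      ≡⟨ cong (_-_ ((v x + V) * laplace (e x) D K)) (laplace-weight μ (e x) D K) ⟩
    (v x + V) * laplace (e x) D K - sum-of μ K * laplace (e x) D K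
      ≡⟨ ring₃ (v x + V) (sum-of μ K) _ ⟩
    (v x + V - sum-of μ K) * laplace (e x) D K ∎
    where
    D = det e xs
    V = sum-of v xs
    A = laplace (e x) (λ L → sum-of μ L * D L) K
    B = laplace (λ k → μ k * e x k) D K
    ring₁ : ∀ a b c → (a - b) * c ≡ a * c + -1ℤ * (b * c)
    ring₁ = solve-∀
    ring₂ : ∀ a b l c d → (a * l + -1ℤ * c) + (b * l + -1ℤ * d) ≡ (b + a) * l - (c + d)
    ring₂ = solve-∀
    ring₃ : ∀ a b c → a * c - b * c ≡ (a - b) * c
    ring₃ = solve-∀

-- Signed sums over sign patterns, and exponent lists.

module SignedSums where

  open Determinants
  open import Data.Integer using (ℤ; +_; 0ℤ; 1ℤ; -1ℤ; _+_; _*_; _-_; -_)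
  open import Data.Integer.Properties using (*-identityˡ; *-zeroʳ; pos-+; +-identityˡ; pos-*)
  open import Data.Integer.Tactic.RingSolver using (solve-∀)
  open import Data.List using (List; []; _∷_; map; length)
  open import Data.List.Membership.Propositional using (_∈_)
  open import Data.List.Relation.Unary.Any using (here; there)
  open import Data.List.Relation.Unary.Linked using (Linked; []; [-]; _∷_)
  import Data.List.Relation.Unary.Linked as Linked
  open import Data.List.Relation.Unary.Linked.Properties using (map⁻; Linked⇒AllPairs)
  open import Data.List.Relation.Unary.AllPairs using (AllPairs; []; _∷_)
  open import Data.List.Relation.Unary.All using (All; []; _∷_)
  open import Data.List.Properties using (length-map)
  open import Data.Nat as ℕ using (ℕ; zero; suc; _≤_; _<_; _>_; z≤n; s≤s; _!)
  open import Data.Nat.ListAction using (sum)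
  import Data.Nat.Properties as ℕₚ
  import Data.Nat.Tactic.RingSolver as ℕ-Solver
  open import Data.Product using (∃; _,_)
  open import Data.Sum using (_⊎_; inj₁; inj₂)
  open import Function using (_∘_; id)
  open import Relation.Binary.Definitions using (tri<; tri≈; tri>)
  open import Relation.Binary.PropositionalEquality
  open import Relation.Nullary using (¬_; contradiction; yes; no)
  open ≡-Reasoning

  -- The weight is ∏ εᵢ, so whatever is even in one of the variables is killed.
  signedSum : List ℤ → (List ℤ → ℤ) → ℤ
  signedSum []       F = F []
  signedSum (a ∷ as) F = signedSum as (F ∘ (a ∷_)) - signedSum as (F ∘ (- a ∷_))

  signedSum-cong : ∀ as {F G} → (∀ xs → F xs ≡ G xs) → signedSum as F ≡ signedSum as G
  signedSum-cong []       p = p []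
  signedSum-cong (a ∷ as) p = cong₂ _-_ (signedSum-cong as (p ∘ (a ∷_))) (signedSum-cong as (p ∘ (- a ∷_)))

  signedSum-zero : ∀ as → signedSum as (λ _ → 0ℤ) ≡ 0ℤ
  signedSum-zero []       = refl
  signedSum-zero (a ∷ as) = cong₂ _-_ (signedSum-zero as) (signedSum-zero as)

  signedSum-linear : ∀ as a b F G →
    signedSum as (λ xs → a * F xs + b * G xs) ≡ a * signedSum as F + b * signedSum as G
  signedSum-linear []       a b F G = refl
  signedSum-linear (c ∷ as) a b F G =
    trans (cong₂ _-_ (signedSum-linear as a b (F ∘ (c ∷_)) (G ∘ (c ∷_)))
                     (signedSum-linear as a b (F ∘ (- c ∷_)) (G ∘ (- c ∷_))))
          (ring a b (signedSum as (F ∘ (c ∷_))) (signedSum as (G ∘ (c ∷_)))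
                    (signedSum as (F ∘ (- c ∷_))) (signedSum as (G ∘ (- c ∷_))))
    where
    ring : ∀ a b f g f′ g′ → a * f + b * g - (a * f′ + b * g′) ≡ a * (f - f′) + b * (g - g′)
    ring = solve-∀

  signedSum-laplace : ∀ {C : Set} as (w : C → ℤ) (G : List ℤ → List C → ℤ) cs →
    signedSum as (λ xs → laplace w (G xs) cs) ≡ laplace w (λ ds → signedSum as (λ xs → G xs ds)) cs
  signedSum-laplace as w G []       = signedSum-zero as
  signedSum-laplace as w G (c ∷ cs) = begin
    signedSum as (λ xs → w c * G xs cs - laplace w (G xs ∘ (c ∷_)) cs)
      ≡⟨ signedSum-cong as (λ xs → ring₁ (w c * G xs cs) (laplace w (G xs ∘ (c ∷_)) cs)) ⟩
    signedSum as (λ xs → w c * G xs cs + -1ℤ * laplace w (G xs ∘ (c ∷_)) cs)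
      ≡⟨ signedSum-linear as (w c) -1ℤ (λ xs → G xs cs) (λ xs → laplace w (G xs ∘ (c ∷_)) cs) ⟩
    w c * A + -1ℤ * signedSum as (λ xs → laplace w (G xs ∘ (c ∷_)) cs)
      ≡⟨ cong (λ z → w c * A + -1ℤ * z) (signedSum-laplace as w (λ xs → G xs ∘ (c ∷_)) cs) ⟩
    w c * A + -1ℤ * B
      ≡⟨ ring₁ (w c * A) B ⟨
    w c * A - B ∎
    where
    A = signedSum as (λ xs → G xs cs)
    B = laplace w (λ ds → signedSum as (λ xs → G xs (c ∷ ds))) cs
    ring₁ : ∀ a b → a - b ≡ a + -1ℤ * b
    ring₁ = solve-∀

  signedSum-∂ : ∀ as (G : List ℤ → List ℕ → ℤ) K →
    signedSum as (λ xs → ∂ (G xs) K) ≡ ∂ (λ L → signedSum as (λ xs → G xs L)) K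
  signedSum-∂ as G []      = signedSum-zero as
  signedSum-∂ as G (k ∷ K) = begin
    signedSum as (λ xs → G xs (suc k ∷ K) + ∂ (G xs ∘ (k ∷_)) K)
      ≡⟨ signedSum-cong as (λ xs → ring (G xs (suc k ∷ K)) (∂ (G xs ∘ (k ∷_)) K)) ⟩
    signedSum as (λ xs → 1ℤ * G xs (suc k ∷ K) + 1ℤ * ∂ (G xs ∘ (k ∷_)) K)
      ≡⟨ signedSum-linear as 1ℤ 1ℤ (λ xs → G xs (suc k ∷ K)) (λ xs → ∂ (G xs ∘ (k ∷_)) K) ⟩
    1ℤ * A + 1ℤ * signedSum as (λ xs → ∂ (G xs ∘ (k ∷_)) K)
      ≡⟨ cong (λ z → 1ℤ * A + 1ℤ * z) (signedSum-∂ as (λ xs → G xs ∘ (k ∷_)) K) ⟩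
    1ℤ * A + 1ℤ * B
      ≡⟨ ring A B ⟨
    A + B ∎
    where
    A = signedSum as (λ xs → G xs (suc k ∷ K))
    B = ∂ (λ L → signedSum as (λ xs → G xs (k ∷ L))) K
    ring : ∀ a b → a + b ≡ 1ℤ * a + 1ℤ * b
    ring = solve-∀

  -- Each row involves one variable only, so by linearity in that row the sum over its sign moves
  -- inside it.
  signedSum-det : ∀ {C : Set} (e : ℤ → C → ℤ) as cs →
    signedSum as (λ xs → det e xs cs) ≡ det (λ a c → e a c - e (- a) c) as cs
  signedSum-det e []       []       = refl
  signedSum-det e []       (c ∷ cs) = refl
  signedSum-det e (a ∷ as) cs = begin
    signedSum as (λ xs → laplace (e a) (det e xs) cs) - signedSum as (λ xs → laplace (e (- a)) (det e xs) cs)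
      ≡⟨ cong₂ _-_ (signedSum-laplace as (e a) (det e) cs) (signedSum-laplace as (e (- a)) (det e) cs) ⟩
    laplace (e a) G cs - laplace (e (- a)) G cs
      ≡⟨ ring (laplace (e a) G cs) (laplace (e (- a)) G cs) ⟩
    1ℤ * laplace (e a) G cs + -1ℤ * laplace (e (- a)) G cs
      ≡⟨ laplace-linearʷ (e a) (e (- a)) 1ℤ -1ℤ G cs ⟨
    laplace (λ c → 1ℤ * e a c + -1ℤ * e (- a) c) G cs
      ≡⟨ laplace-cong (λ c → sym (ring (e a c) (e (- a) c))) (signedSum-det e as) cs ⟩
    laplace (λ c → e a c - e (- a) c) (det (λ a c → e a c - e (- a) c) as) cs ∎
    where
    G = λ ds → signedSum as (λ xs → det e xs ds)
    ring : ∀ a b → a - b ≡ 1ℤ * a + -1ℤ * b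
    ring = solve-∀

  -- The Newton basis with nodes `c`. Powers and falling factorials are both instances, so Pieri's
  -- rule and the column reductions serve both.
  newton : (ℕ → ℤ) → ℤ → ℕ → ℤ
  newton c x zero    = 1ℤ
  newton c x (suc k) = (x - c k) * newton c x k

  pow : ℤ → ℕ → ℤ
  pow = newton (λ _ → 0ℤ)

  fall : ℕ → ℕ → ℤ
  fall r = newton +_ (+ r)

  oddPart : ℤ → ℕ → ℤ
  oddPart a k = pow a k - pow (- a) k

  dbl : ℕ → ℕ
  dbl zero    = zero
  dbl (suc n) = suc (suc (dbl n))

  oddPart-even : ∀ a j → oddPart a (dbl j) ≡ 0ℤ
  oddPart-even a zero    = refl
  oddPart-even a (suc j) = trans (ring a (pow a (dbl j)) (pow (- a) (dbl j)))
    (trans (cong (a * a *_) (oddPart-even a j)) (*-zeroʳ (a * a)))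
    where
    ring : ∀ a b c → (a - 0ℤ) * ((a - 0ℤ) * b) - (- a - 0ℤ) * ((- a - 0ℤ) * c) ≡ a * a * (b - c)
    ring = solve-∀

  -- With 2a taken out of the row, the odd columns form a Vandermonde matrix in the squares.
  oddPart-odd : ∀ a j → oddPart a (suc (dbl j)) ≡ (a + a) * pow (a * a) j
  oddPart-odd a zero    = ring a
    where
    ring : ∀ a → (a - 0ℤ) * 1ℤ - (- a - 0ℤ) * 1ℤ ≡ (a + a) * 1ℤ
    ring = solve-∀
  oddPart-odd a (suc j) = trans (ring₁ a (pow a (dbl j)) (pow (- a) (dbl j)))
    (trans (cong (a * a *_) (oddPart-odd a j)) (ring₂ a (pow (a * a) j)))
    where
    ring₁ : ∀ a b c → (a - 0ℤ) * ((a - 0ℤ) * ((a - 0ℤ) * b)) - (- a - 0ℤ) * ((- a - 0ℤ) * ((- a - 0ℤ) * c))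
            ≡ a * a * ((a - 0ℤ) * b - (- a - 0ℤ) * c)
    ring₁ = solve-∀
    ring₂ : ∀ a b → a * a * ((a + a) * b) ≡ (a + a) * ((a * a - 0ℤ) * b)
    ring₂ = solve-∀

  -- Strictly decreasing exponent lists

  down : ℕ → List ℕ
  down zero    = []
  down (suc n) = n ∷ down n

  odds : ℕ → List ℕ
  odds n = map (suc ∘ dbl) (down n)

  data Bump : List ℕ → List ℕ → Set where
    here  : ∀ {k K} → Bump (k ∷ K) (suc k ∷ K)
    there : ∀ {k K L} → Bump K L → Bump (k ∷ K) (k ∷ L)

  ∂-bump : ∀ {G H} K → (∀ {L} → Bump K L → G L ≡ H L) → ∂ G K ≡ ∂ H K
  ∂-bump []      p = refl
  ∂-bump (k ∷ K) p = cong₂ _+_ (p here) (∂-bump K (p ∘ there))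

  bump-length : ∀ {K L} → Bump K L → length L ≡ length K
  bump-length here      = refl
  bump-length (there b) = cong suc (bump-length b)

  bump-sum : ∀ {K L} → Bump K L → sum L ≡ suc (sum K)
  bump-sum here              = refl
  bump-sum (there {k} {K} b) = trans (cong (k ℕ.+_) (bump-sum b)) (ℕₚ.+-suc k (sum K))

  -- A raised entry stays above its successor and can at most meet its predecessor, in which case
  -- alternants vanish.
  bump-desc : ∀ {K L} → Linked _>_ K → Bump K L → Linked _>_ L ⊎ Repeat L
  bump-desc [-]         here              = inj₁ [-]
  bump-desc (k>l ∷ lk)  here              = inj₁ (ℕₚ.m<n⇒m<1+n k>l ∷ lk)
  bump-desc {k ∷ l ∷ K} (k>l ∷ lk) (there here) with bump-desc lk here | suc l ℕ.≟ k
  ... | inj₂ r  | _        = inj₂ (there r)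
  ... | inj₁ lk′ | yes refl = inj₂ here
  ... | inj₁ lk′ | no ≢k    = inj₁ (ℕₚ.≤∧≢⇒< k>l ≢k ∷ lk′)
  bump-desc (k>l ∷ lk)  (there (there b)) with bump-desc lk (there b)
  ... | inj₂ r   = inj₂ (there r)
  ... | inj₁ lk′ = inj₁ (k>l ∷ lk′)

  length≤head : ∀ {j J} → Linked _>_ (j ∷ J) → length J ≤ j
  length≤head [-]        = z≤n
  length≤head (j>i ∷ lk) = ℕₚ.≤-trans (s≤s (length≤head lk)) j>i

  -- Each entry is at least the number of entries after it, so n - 1, ..., 0 is smallest termwise.
  desc-minimal : ∀ {J} → Linked _>_ J → J ≡ down (length J) ⊎ sum (down (length J)) < sum J
  desc-minimal []          = inj₁ refl
  desc-minimal {j ∷ J} lk with desc-minimal (Linked.tail lk) | ℕₚ.m≤n⇒m<n∨m≡n (length≤head lk)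
  ... | inj₁ eq | inj₂ refl = inj₁ (cong (length J ∷_) eq)
  ... | inj₁ eq | inj₁ n<j  = inj₂ (ℕₚ.+-mono-<-≤ n<j (ℕₚ.≤-reflexive (cong sum (sym eq))))
  ... | inj₂ lt | _         = inj₂ (ℕₚ.+-mono-≤-< (length≤head lk) lt)

  dbl≡ : ∀ j → dbl j ≡ j ℕ.+ j
  dbl≡ zero    = refl
  dbl≡ (suc j) = cong suc (trans (cong suc (dbl≡ j)) (sym (ℕₚ.+-suc j j)))

  sum-odds : ∀ J → sum (map (suc ∘ dbl) J) ≡ length J ℕ.+ (sum J ℕ.+ sum J)
  sum-odds []      = refl
  sum-odds (j ∷ J) rewrite sum-odds J | dbl≡ j = cong suc (ring j (length J) (sum J))
    where
    ring : ∀ j n s → j ℕ.+ j ℕ.+ (n ℕ.+ (s ℕ.+ s)) ≡ n ℕ.+ (j ℕ.+ s ℕ.+ (j ℕ.+ s))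
    ring = ℕ-Solver.solve-∀

  length-down : ∀ n → length (down n) ≡ n
  length-down zero    = refl
  length-down (suc n) = cong suc (length-down n)

  sum-down : ∀ n → n ℕ.+ (sum (down n) ℕ.+ sum (down n)) ≡ n ℕ.* n
  sum-down zero    = refl
  sum-down (suc n) = cong suc (trans (ring₁ n (sum (down n))) (trans (cong (n ℕ.+ n ℕ.+_) (sum-down n)) (ring₂ n)))
    where
    ring₁ : ∀ n s → n ℕ.+ (n ℕ.+ s ℕ.+ (n ℕ.+ s)) ≡ n ℕ.+ n ℕ.+ (n ℕ.+ (s ℕ.+ s))
    ring₁ = ℕ-Solver.solve-∀
    ring₂ : ∀ n → n ℕ.+ n ℕ.+ n ℕ.* n ≡ n ℕ.+ n ℕ.* suc n
    ring₂ = ℕ-Solver.solve-∀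

  even⊎odd : ∀ k → (∃ λ j → k ≡ dbl j) ⊎ (∃ λ j → k ≡ suc (dbl j))
  even⊎odd zero    = inj₁ (0 , refl)
  even⊎odd (suc k) with even⊎odd k
  ... | inj₁ (j , refl) = inj₂ (j , refl)
  ... | inj₂ (j , refl) = inj₁ (suc j , refl)

  even-member : ∀ K → (∃ λ j → dbl j ∈ K) ⊎ (∃ λ J → K ≡ map (suc ∘ dbl) J)
  even-member []      = inj₂ ([] , refl)
  even-member (k ∷ K) with even⊎odd k | even-member K
  ... | inj₁ (j , refl) | _               = inj₁ (j , here refl)
  ... | inj₂ _          | inj₁ (j , j∈K)  = inj₁ (j , there j∈K)
  ... | inj₂ (j , refl) | inj₂ (J , refl) = inj₂ (j ∷ J , refl)

  dbl-cancel-< : ∀ i j → dbl i < dbl j → i < j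
  dbl-cancel-< zero    (suc j) _             = s≤s z≤n
  dbl-cancel-< (suc i) (suc j) (s≤s (s≤s p)) = s≤s (dbl-cancel-< i j p)

  -- Write n odd entries as 2j + 1. The numbers j strictly decrease, so the sum is at least n + n(n
  -- - 1) = n², with equality only for the first n odd numbers.
  odds-minimal : ∀ {K} → Linked _>_ K → sum K ≤ length K ℕ.* length K →
                 (∃ λ j → dbl j ∈ K) ⊎ K ≡ odds (length K)
  odds-minimal {K} lk le with even-member K
  ... | inj₁ e          = inj₁ e
  ... | inj₂ (J , refl) with desc-minimal (Linked.map (λ { (s≤s p) → dbl-cancel-< _ _ p }) (map⁻ lk))
  ...   | inj₁ eq = inj₂ (cong (map _) (trans eq (cong down (sym (length-map _ J)))))
  ...   | inj₂ lt = contradiction le (ℕₚ.<⇒≱ (subst₂ _<_ (trans (sum-down n) (cong₂ ℕ._*_ n≡ n≡)) (sym (sum-odds J))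
                      (ℕₚ.+-monoʳ-< n (ℕₚ.+-mono-< lt lt))))
    where
    n  = length J
    n≡ = sym (length-map (suc ∘ dbl) J)

  -- Determinants of falling factorials

  pick-sum : ∀ {k K L} → Pick K k L → sum K ≡ k ℕ.+ sum L
  pick-sum here                      = refl
  pick-sum (there {b} {k} {_} {L} p) = trans (cong (b ℕ.+_) (pick-sum p)) (ring b k (sum L))
    where
    ring : ∀ b k s → b ℕ.+ (k ℕ.+ s) ≡ k ℕ.+ (b ℕ.+ s)
    ring = ℕ-Solver.solve-∀

  pick-desc : ∀ {k K L} → AllPairs _>_ K → Pick K k L → AllPairs _>_ L
  pick-desc (_ ∷ ap)   here      = ap
  pick-desc (a>  ∷ ap) (there p) = pick-all a> p ∷ pick-desc ap p
    where
    pick-all : ∀ {P : ℕ → Set} {k K L} → All P K → Pick K k L → All P L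
    pick-all (_ ∷ ps) here      = ps
    pick-all (q ∷ ps) (there p) = q ∷ pick-all ps p

  -- A head `b` other than the picked `r` would exceed `r` in `K` and lie below it in `r ∷ rs`.
  pick-head : ∀ {r K rs} → AllPairs _>_ K → AllPairs _>_ (r ∷ rs) → Pick K r rs → K ≡ r ∷ rs
  pick-head _          _                 here      = refl
  pick-head (b> ∷ _)   ((r>b ∷ _) ∷ _)   (there p) = contradiction (at b> p) (ℕₚ.<-asym r>b)
    where
    at : ∀ {P : ℕ → Set} {k K L} → All P K → Pick K k L → P k
    at (q ∷ _)  here      = q
    at (_ ∷ qs) (there p) = at qs p

  fall-zero : ∀ r k → r < k → fall r k ≡ 0ℤ
  fall-zero r (suc k) (s≤s r≤k) with ℕₚ.m≤n⇒m<n∨m≡n r≤k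
  ... | inj₁ r<k  = trans (cong ((+ r - + k) *_) (fall-zero r k r<k)) (*-zeroʳ (+ r - + k))
  ... | inj₂ refl = cong (_* fall r r) (ring (+ r))
    where
    ring : ∀ a → a - a ≡ 0ℤ
    ring = solve-∀

  *-zero⊎ : ∀ x y → x ≡ 0ℤ ⊎ y ≡ 0ℤ → x * y ≡ 0ℤ
  *-zero⊎ x y (inj₁ refl) = refl
  *-zero⊎ x y (inj₂ refl) = *-zeroʳ x

  -- Since `fall r k` vanishes for r < k, a nonzero term gives each row a column not above it, which
  -- forces `sum K` to be at most `sum rs`.
  det-fall-large : ∀ rs K → sum rs < sum K → det fall rs K ≡ 0ℤ
  det-fall-large []       (k ∷ K) _  = refl
  det-fall-large (r ∷ rs) K       lt = laplace-zero (fall r) (det fall rs) K λ {k} {L} p →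
    *-zero⊎ (fall r k) (det fall rs L) (factor p)
    where
    factor : ∀ {k L} → Pick K k L → fall r k ≡ 0ℤ ⊎ det fall rs L ≡ 0ℤ
    factor {k} {L} p with r ℕ.<? k
    ... | yes r<k = inj₁ (fall-zero r k r<k)
    ... | no  r≮k = inj₂ (det-fall-large rs L (ℕₚ.+-cancelˡ-< r _ _
            (ℕₚ.<-≤-trans (subst (r ℕ.+ sum rs <_) (pick-sum p) lt) (ℕₚ.+-monoˡ-≤ (sum L) (ℕₚ.≮⇒≥ r≮k)))))

  -- With equal sums, a nonzero term must give each row the column equal to it. In `S-top` this
  -- matches the vanishing of `S 0` on lists with an even entry.
  det-fall-≢ : ∀ rs K → AllPairs _>_ rs → AllPairs _>_ K → sum rs ≡ sum K → K ≢ rs → det fall rs K ≡ 0ℤ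
  det-fall-≢ []       []      _          _  _  K≢ = contradiction refl K≢
  det-fall-≢ []       (k ∷ K) _          _  _  _  = refl
  det-fall-≢ (r ∷ rs) K  ap@(_ ∷ aprs) apK eq K≢ = laplace-zero (fall r) (det fall rs) K λ {k} {L} p →
    *-zero⊎ (fall r k) (det fall rs L) (factor p)
    where
    factor : ∀ {k L} → Pick K k L → fall r k ≡ 0ℤ ⊎ det fall rs L ≡ 0ℤ
    factor {k} {L} p with ℕₚ.<-cmp r k
    ... | tri< r<k _ _  = inj₁ (fall-zero r k r<k)
    ... | tri≈ _ refl _ = inj₂ (det-fall-≢ rs L aprs (pick-desc apK p)
            (ℕₚ.+-cancelˡ-≡ r _ _ (trans eq (pick-sum p))) λ { refl → K≢ (pick-head apK ap p) })
    ... | tri> _ _ k<r  = inj₂ (det-fall-large rs L (ℕₚ.+-cancelˡ-< k _ _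
            (subst (k ℕ.+ sum rs <_) (trans eq (pick-sum p)) (ℕₚ.+-monoˡ-< (sum rs) k<r))))

  -- Signed sums of alternants times a product of linear factors.

  module SignedAlternants (as : List ℤ) (τ : ℕ → ℤ) (d : ℕ) where

    shifted : ℕ → ℤ → ℤ
    shifted zero    y = 1ℤ
    shifted (suc n) y = (y + τ n) * shifted n y

    S : ℕ → List ℕ → ℤ
    S n K = signedSum as (λ xs → shifted n (sum-of id xs) * det pow xs K)

    S-zero : ∀ K → S 0 K ≡ det oddPart as K
    S-zero K = trans (signedSum-cong as (λ xs → *-identityˡ (det pow xs K))) (signedSum-det pow as K)

    -- Of the new factor, the sum of the variables raises an exponent by Pieri's rule, and the
    -- constant `τ n` leaves the exponents alone.
    S-suc : ∀ n K → S (suc n) K ≡ ∂ (S n) K + τ n * S n K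
    S-suc n K = begin
      signedSum as (λ xs → (sum-of id xs + τ n) * f xs * det pow xs K)
        ≡⟨ signedSum-cong as split ⟩
      signedSum as (λ xs → 1ℤ * ∂ (λ L → f xs * det pow xs L) K + τ n * (f xs * det pow xs K))
        ≡⟨ signedSum-linear as 1ℤ (τ n) (λ xs → ∂ (λ L → f xs * det pow xs L) K) (λ xs → f xs * det pow xs K) ⟩
      1ℤ * signedSum as (λ xs → ∂ (λ L → f xs * det pow xs L) K) + τ n * S n K
        ≡⟨ cong (_+ τ n * S n K) (trans (*-identityˡ _) (signedSum-∂ as (λ xs L → f xs * det pow xs L) K)) ⟩
      ∂ (S n) K + τ n * S n K ∎
      where
      f : List ℤ → ℤ
      f xs = shifted n (sum-of id xs)
      sum-zero : ∀ K → sum-of (λ (_ : ℕ) → 0ℤ) K ≡ 0ℤ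
      sum-zero []      = refl
      sum-zero (_ ∷ K) = trans (+-identityˡ _) (sum-zero K)
      ring : ∀ s t f d → (s + t) * f * d ≡ 1ℤ * (f * ((s - 0ℤ) * d)) + t * (f * d)
      ring = solve-∀
      split : ∀ xs → (sum-of id xs + τ n) * f xs * det pow xs K
              ≡ 1ℤ * ∂ (λ L → f xs * det pow xs L) K + τ n * (f xs * det pow xs K)
      split xs = trans (ring (sum-of id xs) (τ n) (f xs) (det pow xs K))
        (cong (λ z → 1ℤ * z + τ n * (f xs * det pow xs K)) (sym (trans (∂-scale (f xs) (det pow xs) K)
          (cong (f xs *_) (trans (∂-det id (λ _ → 0ℤ) pow (λ _ _ → refl) xs K)
            (cong (λ z → (sum-of id xs - z) * det pow xs K) (sum-zero K)))))))

    S-repeat : ∀ n {K} → Repeat K → S n K ≡ 0ℤ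
    S-repeat n {K} r = trans (signedSum-cong as (λ xs →
      trans (cong (shifted n (sum-of id xs) *_) (det-repeat pow xs r)) (*-zeroʳ (shifted n (sum-of id xs)))))
      (signedSum-zero as)

    S-even : ∀ {j K} → dbl j ∈ K → S 0 K ≡ 0ℤ
    S-even {j} {K} j∈K = trans (S-zero K) (det-zeroColumn oddPart as j∈K (λ a → oddPart-even a j))

    sum-odds-d : sum (odds d) ≡ d ℕ.* d
    sum-odds-d = trans (sum-odds (down d)) (trans (cong (ℕ._+ (sum (down d) ℕ.+ sum (down d))) (length-down d)) (sum-down d))

    -- Each linear factor raises the exponent sum by at most one. When none is left the sum is still
    -- below d², so the list has a repetition or an even exponent, and both give 0.
    S-small : ∀ n {K} → Linked _>_ K → length K ≡ d → sum K ℕ.+ n < d ℕ.* d → S n K ≡ 0ℤ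
    S-small zero {K} lk refl lt rewrite ℕₚ.+-identityʳ (sum K) with odds-minimal lk (ℕₚ.<⇒≤ lt)
    ... | inj₁ (j , j∈K) = S-even {j} j∈K
    ... | inj₂ eq        = contradiction (trans (cong sum eq) sum-odds-d) (ℕₚ.<⇒≢ lt)
    S-small (suc n) {K} lk len lt = begin
      S (suc n) K             ≡⟨ S-suc n K ⟩
      ∂ (S n) K + τ n * S n K ≡⟨ cong₂ _+_ (trans (∂-bump K vanish) (∂-zero K))
                                   (trans (cong (τ n *_) (S-small n lk len (ℕₚ.<-trans (ℕₚ.+-monoʳ-< (sum K) ℕₚ.≤-refl) lt)))
                                          (*-zeroʳ (τ n))) ⟩
      0ℤ ∎
      where
      vanish : ∀ {L} → Bump K L → S n L ≡ 0ℤ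
      vanish {L} b with bump-desc lk b
      ... | inj₂ r   = S-repeat n r
      ... | inj₁ lk′ = S-small n lk′ (trans (bump-length b) len)
        (subst (_< d ℕ.* d) (trans (ℕₚ.+-suc (sum K) n) (cong (ℕ._+ n) (sym (bump-sum b)))) lt)

    D : List ℕ → ℤ
    D = det fall (odds d)

    odds-desc : ∀ n → AllPairs _>_ (odds n)
    odds-desc n = Linked⇒AllPairs (λ i>j j>k → ℕₚ.<-trans j>k i>j) (go n)
      where
      go : ∀ n → Linked _>_ (odds n)
      go zero          = []
      go (suc zero)    = [-]
      go (suc (suc n)) = s≤s (s≤s (ℕₚ.n≤1+n _)) ∷ go (suc n)

    -- In top degree the constants drop out by `S-small`, and both sides obey the recursion given by
    -- `∂` alone: d² exceeds the sum of `K` by `suc n`, so `∂ D K` is `suc n` times `D K`, which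
    -- builds up the factorial. As `D (odds d)` is ∏ ρᵢ!, keeping it on the left avoids a division.
    S-top : ∀ n {K} → Linked _>_ K → length K ≡ d → sum K ℕ.+ n ≡ d ℕ.* d →
            D (odds d) * S n K ≡ + (n !) * (D K * S 0 (odds d))
    S-top zero {K} lk refl eq rewrite ℕₚ.+-identityʳ (sum K) with odds-minimal lk (ℕₚ.≤-reflexive eq)
    ... | inj₂ K≡ = subst (λ L → D (odds d) * S 0 L ≡ 1ℤ * (D L * S 0 (odds d))) (sym K≡)
                      (sym (*-identityˡ (D (odds d) * S 0 (odds d))))
    -- Both sides are 0: the even exponent gives a zero column in `S 0 K`, and `D K` vanishes
    -- because `K` differs from `odds d` but has the same sum.
    ... | inj₁ (j , j∈K) = trans (trans (cong (D (odds d) *_) (S-even {j} j∈K)) (*-zeroʳ (D (odds d))))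
      (sym (trans (*-identityˡ (D K * S 0 (odds d))) (*-zero⊎ (D K) _ D⊎S)))
      where
      D⊎S : D K ≡ 0ℤ ⊎ S 0 (odds d) ≡ 0ℤ
      D⊎S = inj₁ (det-fall-≢ (odds d) K (odds-desc d) (Linked⇒AllPairs (λ i>j j>k → ℕₚ.<-trans j>k i>j) lk)
        (trans sum-odds-d (sym eq)) (λ K≡ → not-odd (subst (dbl j ∈_) K≡ j∈K)))
        where
        dbl≢ : ∀ i j → dbl i ≢ suc (dbl j)
        dbl≢ (suc i) (suc j) p = dbl≢ i j (ℕₚ.suc-injective (ℕₚ.suc-injective p))
        not-odd : ∀ {J} → ¬ dbl j ∈ map (suc ∘ dbl) J
        not-odd {i ∷ J} (here p)  = dbl≢ j i p
        not-odd {i ∷ J} (there m) = not-odd {J} m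
    S-top (suc n) {K} lk len eq = begin
      D ρ * S (suc n) K
        ≡⟨ cong (D ρ *_) (S-suc n K) ⟩
      D ρ * (∂ (S n) K + τ n * S n K)
        ≡⟨ cong (λ z → D ρ * (∂ (S n) K + τ n * z)) (S-small n lk len (subst (sum K ℕ.+ n <_) eq (ℕₚ.+-monoʳ-< (sum K) ℕₚ.≤-refl))) ⟩
      D ρ * (∂ (S n) K + τ n * 0ℤ)
        ≡⟨ ring₁ (D ρ) (∂ (S n) K) (τ n) ⟩
      D ρ * ∂ (S n) K
        ≡⟨ ∂-scale (D ρ) (S n) K ⟨
      ∂ (λ L → D ρ * S n L) K
        ≡⟨ ∂-bump K step ⟩
      ∂ (λ L → + (n !) * S 0 ρ * D L) K
        ≡⟨ ∂-scale (+ (n !) * S 0 ρ) D K ⟩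
      + (n !) * S 0 ρ * ∂ D K
        ≡⟨ cong (+ (n !) * S 0 ρ *_) (∂-det +_ +_ fall (λ _ _ → refl) ρ K) ⟩
      + (n !) * S 0 ρ * ((sum-of +_ ρ - sum-of +_ K) * D K)
        ≡⟨ cong (λ z → + (n !) * S 0 ρ * (z * D K)) difference ⟩
      + (n !) * S 0 ρ * (+ suc n * D K)
        ≡⟨ ring₂ (+ (n !)) (S 0 ρ) (+ suc n) (D K) ⟩
      + suc n * + (n !) * (D K * S 0 ρ)
        ≡⟨ cong (_* (D K * S 0 ρ)) (sym (pos-* (suc n) (n !))) ⟩
      + (suc n !) * (D K * S 0 ρ) ∎
      where
      ρ = odds d
      ring₁ : ∀ a b c → a * (b + c * 0ℤ) ≡ a * b
      ring₁ = solve-∀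
      ring₂ : ∀ f s m e → f * s * (m * e) ≡ m * f * (e * s)
      ring₂ = solve-∀
      ring₃ : ∀ a b → a + b - a ≡ b
      ring₃ = solve-∀
      ring₄ : ∀ a b c → a * (b * c) ≡ a * c * b
      ring₄ = solve-∀
      sum-of-pos : ∀ K → sum-of +_ K ≡ + sum K
      sum-of-pos []      = refl
      sum-of-pos (k ∷ K) = trans (cong (_+_ (+ k)) (sum-of-pos K)) (sym (pos-+ k (sum K)))
      difference : sum-of +_ ρ - sum-of +_ K ≡ + suc n
      difference rewrite sum-of-pos ρ | sum-of-pos K | sum-odds-d | sym eq | pos-+ (sum K) (suc n) =
        ring₃ (+ sum K) (+ suc n)
      step : ∀ {L} → Bump K L → D ρ * S n L ≡ + (n !) * S 0 ρ * D L
      step {L} b with bump-desc lk b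
      ... | inj₂ r   = trans (trans (cong (D ρ *_) (S-repeat n r)) (*-zeroʳ (D ρ)))
                         (sym (trans (cong (+ (n !) * S 0 ρ *_) (det-repeat fall ρ r)) (*-zeroʳ (+ (n !) * S 0 ρ))))
      ... | inj₁ lk′ = trans (S-top n lk′ (trans (bump-length b) len)
        (trans (cong (ℕ._+ n) (bump-sum b)) (trans (sym (ℕₚ.+-suc (sum K) n)) eq)))
        (ring₄ (+ (n !)) (D L) (S 0 ρ))

-- Column operations; determinants with one exponent skipped.

module ColumnOperations where

  open Determinants
  open SignedSums
  open import Data.Integer using (ℤ; +_; 0ℤ; 1ℤ; _+_; _*_; _-_; -_)
  open import Data.Integer.Properties using (*-identityˡ; *-zeroʳ; pos-+; pos-*; *-identityʳ)
  open import Data.Integer.Tactic.RingSolver using (solve-∀)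
  open import Data.List using (List; []; _∷_; _++_; map; length)
  open import Data.List.Properties using (length-map; map-id)
  open import Data.List.Relation.Unary.Linked using (Linked; []; [-]; _∷_)
  open import Data.Nat as ℕ using (ℕ; zero; suc; _>_; s≤s; _!)
  open import Data.Nat.ListAction using (sum)
  import Data.Nat.Properties as ℕₚ
  import Data.Nat.Tactic.RingSolver as ℕ-Solver
  open import Function using (_∘_; id)
  open import Relation.Binary.PropositionalEquality
  open ≡-Reasoning

  private variable
    X : Set

  -- Columns are functions on the rows, so that linear combinations of columns are columns again.
  apply : X → (X → ℤ) → ℤ
  apply x f = f x

  -- In `linear` the combined column is any `h` with the right values, which avoids function
  -- extensionality.
  record Alternating (G : List (X → ℤ) → ℤ) : Set where
    field
      linear : ∀ {f g h} l us vs → (∀ x → h x ≡ f x + l * g x) →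
               G (us ++ h ∷ vs) ≡ G (us ++ f ∷ vs) + l * G (us ++ g ∷ vs)
      repeat : ∀ {fs} → Repeat fs → G fs ≡ 0ℤ

  open Alternating

  cons : ∀ {G : List (X → ℤ) → ℤ} f → Alternating G → Alternating (G ∘ (f ∷_))
  cons f alt .linear l us vs eq = linear alt l (f ∷ us) vs eq
  cons f alt .repeat r          = repeat alt (there r)

  laplace-column : ∀ x (G : List (X → ℤ) → ℤ) → Alternating G → ∀ {f g h} l us vs →
    (∀ x → h x ≡ f x + l * g x) →
    laplace (apply x) G (us ++ h ∷ vs) ≡ laplace (apply x) G (us ++ f ∷ vs) + l * laplace (apply x) G (us ++ g ∷ vs)
  laplace-column x G alt {f} {g} {h} l [] vs eq = begin
    h x * G vs - laplace (apply x) (G ∘ (h ∷_)) vs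
      ≡⟨ cong₂ (λ a b → a * G vs - b) (eq x) (trans
           (laplace-cong {w = apply x} (λ _ → refl) (λ ds → trans (linear alt l [] ds eq)
             (cong (_+ l * G (g ∷ ds)) (sym (*-identityˡ (G (f ∷ ds)))))) vs)
           (laplace-linear (apply x) 1ℤ l (G ∘ (f ∷_)) (G ∘ (g ∷_)) vs)) ⟩
    (f x + l * g x) * G vs - (1ℤ * F + l * H)
      ≡⟨ ring (f x) (g x) l (G vs) F H ⟩
    f x * G vs - F + l * (g x * G vs - H) ∎
    where
    F = laplace (apply x) (G ∘ (f ∷_)) vs
    H = laplace (apply x) (G ∘ (g ∷_)) vs
    ring : ∀ f g l a b c → (f + l * g) * a - (1ℤ * b + l * c) ≡ f * a - b + l * (g * a - c)
    ring = solve-∀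
  laplace-column x G alt {f} {g} {h} l (u ∷ us) vs eq =
    trans (cong₂ (λ a b → u x * a - b) (linear alt l us vs eq) (laplace-column x (G ∘ (u ∷_)) (cons u alt) l us vs eq))
          (ring (u x) (G (us ++ f ∷ vs)) l (G (us ++ g ∷ vs))
            (laplace (apply x) (G ∘ (u ∷_)) (us ++ f ∷ vs)) (laplace (apply x) (G ∘ (u ∷_)) (us ++ g ∷ vs)))
    where
    ring : ∀ u a l b c d → u * (a + l * b) - (c + l * d) ≡ u * a - c + l * (u * b - d)
    ring = solve-∀

  det-alternating : ∀ (xs : List X) → Alternating (det apply xs)
  det-alternating [] .linear l []       vs eq = sym (cong (_+_ 0ℤ) (*-zeroʳ l))
  det-alternating [] .linear l (u ∷ us) vs eq = sym (cong (_+_ 0ℤ) (*-zeroʳ l))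
  det-alternating []       .repeat r = det-repeat apply [] r
  det-alternating (x ∷ xs) .linear   = laplace-column x (det apply xs) (det-alternating xs)
  det-alternating (x ∷ xs) .repeat r = det-repeat apply (x ∷ xs) r

  -- Each column absorbs a multiple of the next one as it was before its own change.
  data _⇝_ {X : Set} : List (X → ℤ) → List (X → ℤ) → Set where
    last : ∀ {f} → (f ∷ []) ⇝ (f ∷ [])
    step : ∀ {f g h fs hs} l → (∀ x → h x ≡ f x + l * g x) → (g ∷ fs) ⇝ hs → (f ∷ g ∷ fs) ⇝ (h ∷ hs)

  -- Absorbing a multiple of the next column adds a determinant with two equal adjacent columns.
  -- Working from the left, that next column is still unchanged.
  ⇝-alternating : ∀ {G : List (X → ℤ) → ℤ} → Alternating G → ∀ {fs hs} → fs ⇝ hs → G fs ≡ G hs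
  ⇝-alternating alt last = refl
  ⇝-alternating {G = G} alt (step {f} {g} {h} {fs} l eq r) = begin
    G (f ∷ g ∷ fs)                            ≡⟨ ring (G (f ∷ g ∷ fs)) l ⟩
    G (f ∷ g ∷ fs) + l * 0ℤ                   ≡⟨ cong (λ z → G (f ∷ g ∷ fs) + l * z) (repeat alt here) ⟨
    G (f ∷ g ∷ fs) + l * G (g ∷ g ∷ fs)       ≡⟨ linear alt l [] (g ∷ fs) eq ⟨
    G (h ∷ g ∷ fs)                            ≡⟨ ⇝-alternating (cons h alt) r ⟩
    _                                         ∎
    where
    ring : ∀ a l → a ≡ a + l * 0ℤ
    ring = solve-∀

  sgn : ℕ → ℤ
  sgn zero    = 1ℤ
  sgn (suc n) = - sgn n

  -- All columns but the last vanish at `x`, so one term survives; its sign counts the columns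
  -- before it.
  laplace-last : ∀ (x : X) G (ψ : (X → ℤ) → (X → ℤ)) → (∀ f → ψ f x ≡ 0ℤ) → ∀ fs l →
    laplace (apply x) G (map ψ fs ++ l ∷ []) ≡ sgn (length fs) * (l x * G (map ψ fs))
  laplace-last x G ψ z []       l = ring (l x * G [])
    where
    ring : ∀ a → a - 0ℤ ≡ 1ℤ * a
    ring = solve-∀
  laplace-last x G ψ z (f ∷ fs) l =
    trans (cong₂ (λ a b → a * G (map ψ fs ++ l ∷ []) - b) (z f) (laplace-last x (G ∘ (ψ f ∷_)) ψ z fs l))
          (ring (G (map ψ fs ++ l ∷ [])) (sgn (length fs)) (l x * G (ψ f ∷ map ψ fs)))
    where
    ring : ∀ a s b → 0ℤ * a - s * b ≡ - s * b
    ring = solve-∀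

  -- The exponents 0, …, s + q without q, in decreasing order.
  gap : ℕ → ℕ → List ℕ
  gap zero    q = down q
  gap (suc s) q = suc (s ℕ.+ q) ∷ gap s q

  length-gap : ∀ s q → length (gap s q) ≡ s ℕ.+ q
  length-gap zero    q = length-down q
  length-gap (suc s) q = cong suc (length-gap s q)

  gap-desc : ∀ s q → Linked _>_ (gap s q)
  gap-desc zero    zero          = []
  gap-desc zero    (suc zero)    = [-]
  gap-desc zero    (suc (suc q)) = ℕₚ.≤-refl ∷ gap-desc zero (suc q)
  gap-desc (suc s) q             with s in eq | q
  ... | zero   | zero  = [-]
  -- The list jumps over the missing exponent here, from r + 2 to r.
  ... | zero   | suc r = s≤s (ℕₚ.n≤1+n r) ∷ gap-desc zero (suc r)
  ... | suc s′ | r     = ℕₚ.≤-refl ∷ gap-desc (suc s′) r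

  sum-gap : ∀ s q → sum (gap s q) ≡ s ℕ.+ sum (down (s ℕ.+ q))
  sum-gap zero    q = refl
  sum-gap (suc s) q = cong suc (trans (cong (s ℕ.+ q ℕ.+_) (sum-gap s q)) (ring (s ℕ.+ q) s (sum (down (s ℕ.+ q)))))
    where
    ring : ∀ n s t → n ℕ.+ (s ℕ.+ t) ≡ s ℕ.+ (n ℕ.+ t)
    ring = ℕ-Solver.solve-∀

  module Gap {X : Set} (v : X → ℤ) (c : ℕ → ℤ) where

    e : X → ℕ → ℤ
    e x = newton c (v x)

    col : ℕ → X → ℤ
    col k x = e x k

    det-col : ∀ xs K → det apply xs (map col K) ≡ det e xs K
    det-col xs K = trans (det-scaleRows apply e (λ _ → 1ℤ) id col (λ x k → sym (*-identityˡ (e x k))) xs K)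
      (trans (cong₂ _*_ (ones xs) (cong (λ ys → det e ys K) (map-id xs))) (*-identityˡ _))
      where
      ones : ∀ (xs : List X) → product-of (λ _ → 1ℤ) xs ≡ 1ℤ
      ones []       = refl
      ones (x ∷ xs) = trans (*-identityˡ _) (ones xs)

    -- The sign turns each factor into `v y - v x`: the share of row `y` in the Vandermonde product.
    differences : X → List X → ℤ
    differences y xs = sgn (length xs) * product-of (λ x → v x - v y) xs

    vandermonde : List X → ℤ
    vandermonde []       = 1ℤ
    vandermonde (y ∷ xs) = differences y xs * vandermonde xs

    ψ : X → (X → ℤ) → X → ℤ
    ψ y f x = (v x - v y) * f x

    -- One elimination step. The columns made by `ψ y` vanish at `y`, so expanding along that row
    -- leaves only `l y`, and each other row then releases its factor `v x - v y`.
    det-reduce : ∀ y xs hs l {fs} → length hs ≡ length xs → fs ⇝ (map (ψ y) hs ++ l ∷ []) →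
      det apply (y ∷ xs) fs ≡ differences y xs * (l y * det apply xs hs)
    det-reduce y xs hs l {fs} len r = begin
      det apply (y ∷ xs) fs
        ≡⟨ ⇝-alternating (det-alternating (y ∷ xs)) r ⟩
      laplace (apply y) (det apply xs) (map (ψ y) hs ++ l ∷ [])
        ≡⟨ laplace-last y (det apply xs) (ψ y) (λ f → ring₁ (v y) (f y)) hs l ⟩
      sgn (length hs) * (l y * det apply xs (map (ψ y) hs))
        ≡⟨ cong₂ (λ n z → sgn n * (l y * z)) len (det-scaleRows apply apply (λ x → v x - v y) id (ψ y) (λ _ _ → refl) xs hs) ⟩
      sgn (length xs) * (l y * (P * det apply (map id xs) hs))
        ≡⟨ cong (λ ys → sgn (length xs) * (l y * (P * det apply ys hs))) (map-id xs) ⟩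
      sgn (length xs) * (l y * (P * det apply xs hs))
        ≡⟨ ring₂ (sgn (length xs)) (l y) P (det apply xs hs) ⟩
      differences y xs * (l y * det apply xs hs) ∎
      where
      P = product-of (λ x → v x - v y) xs
      ring₁ : ∀ a b → (a - a) * b ≡ 0ℤ
      ring₁ = solve-∀
      ring₂ : ∀ s a p d → s * (a * (p * d)) ≡ s * p * (a * d)
      ring₂ = solve-∀

    ψ-col : ∀ y k x → ψ y (col k) x ≡ col (suc k) x + (c k - v y) * col k x
    ψ-col y k x = ring (v x) (v y) (c k) (e x k)
      where
      ring : ∀ x y c e → (x - y) * e ≡ (x - c) * e + (c - y) * e
      ring = solve-∀

    -- By `ψ-col`, column k + 1 becomes `ψ y (col k)` by absorbing a multiple of its right
    -- neighbour, column k. Only column 0 is left over.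
    down-⇝ : ∀ y n → map col (down (suc n)) ⇝ (map (ψ y) (map col (down n)) ++ col 0 ∷ [])
    down-⇝ y zero    = last
    down-⇝ y (suc n) = step (c n - v y) (ψ-col y n) (down-⇝ y n)

    det-down : ∀ xs → det e xs (down (length xs)) ≡ vandermonde xs
    det-down []       = refl
    det-down (y ∷ xs) = begin
      det e (y ∷ xs) (down (suc n))
        ≡⟨ det-col (y ∷ xs) (down (suc n)) ⟨
      det apply (y ∷ xs) (map col (down (suc n)))
        ≡⟨ det-reduce y xs (map col (down n)) (col 0) (trans (length-map col (down n)) (length-down n)) (down-⇝ y n) ⟩
      differences y xs * (1ℤ * det apply xs (map col (down n)))
        ≡⟨ cong (differences y xs *_) (trans (*-identityˡ _) (trans (det-col xs (down n)) (det-down xs))) ⟩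
      differences y xs * vandermonde xs ∎
      where n = length xs

    gap₀-⇝ : ∀ y s → map col (gap (suc s) 0) ⇝ (map (ψ y) (map col (gap s 0)) ++ col 1 ∷ [])
    gap₀-⇝ y zero    = last
    gap₀-⇝ y (suc s) = step (c (suc (s ℕ.+ 0)) - v y) (ψ-col y (suc (s ℕ.+ 0))) (gap₀-⇝ y s)

    det-gap₀ : ∀ y xs s → length xs ≡ s →
      det e (y ∷ xs) (gap (suc s) 0) ≡ differences y xs * ((v y - c 0) * det e xs (gap s 0))
    det-gap₀ y xs s len = begin
      det e (y ∷ xs) (gap (suc s) 0)
        ≡⟨ det-col (y ∷ xs) (gap (suc s) 0) ⟨
      det apply (y ∷ xs) (map col (gap (suc s) 0))
        ≡⟨ det-reduce y xs (map col (gap s 0)) (col 1) len′ (gap₀-⇝ y s) ⟩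
      differences y xs * ((v y - c 0) * 1ℤ * det apply xs (map col (gap s 0)))
        ≡⟨ cong (differences y xs *_) (cong₂ _*_ (*-identityʳ (v y - c 0)) (det-col xs (gap s 0))) ⟩
      differences y xs * ((v y - c 0) * det e xs (gap s 0)) ∎
      where
      len′ : length (map col (gap s 0)) ≡ length xs
      len′ = trans (length-map col (gap s 0)) (trans (length-gap s 0) (trans (ℕₚ.+-identityʳ s) (sym len)))

    -- Across the gap, columns q + 2 and q are neighbours. The quadratic (x - c_q)(x - c_{q+1})
    -- minus its value at y is (x - y)(x + y - c_q - c_{q+1}); `merged` is the cofactor of x - y
    -- times the Newton polynomial of degree q.
    merged : X → ℕ → X → ℤ
    merged y q x = col (suc q) x + (v y - c (suc q)) * col q x

    gapCols : X → ℕ → ℕ → List (X → ℤ)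
    gapCols y zero    q = merged y q ∷ map col (down q)
    gapCols y (suc s) q = col (suc (s ℕ.+ suc q)) ∷ gapCols y s q

    gap-⇝ : ∀ y s q → map col (gap (suc s) (suc q)) ⇝ (map (ψ y) (gapCols y s q) ++ col 0 ∷ [])
    gap-⇝ y zero    q = step ((v y - c (suc q)) * (c q - v y))
      (λ x → ring (v x) (v y) (c (suc q)) (c q) (e x q)) (down-⇝ y q)
      where
      ring : ∀ x y c c′ e → (x - y) * ((x - c′) * e + (y - c) * e)
             ≡ (x - c) * ((x - c′) * e) + (y - c) * (c′ - y) * e
      ring = solve-∀
    gap-⇝ y (suc s) q = step (c (suc (s ℕ.+ suc q)) - v y) (ψ-col y (suc (s ℕ.+ suc q))) (gap-⇝ y s q)

    length-gapCols : ∀ y s q → length (gapCols y s q) ≡ s ℕ.+ suc q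
    length-gapCols y zero    q = cong suc (trans (length-map col (down q)) (length-down q))
    length-gapCols y (suc s) q = cong suc (length-gapCols y s q)

    -- `merged` combines columns q + 1 and q. With the first the missing exponent is q, with the
    -- second it is q + 1; hence the Pascal-like recursion of `det-gap`.
    gapCols-split : ∀ (G : List (X → ℤ) → ℤ) → Alternating G → ∀ y s q →
      G (gapCols y s q) ≡ G (map col (gap (suc s) q)) + (v y - c (suc q)) * G (map col (gap s (suc q)))
    gapCols-split G alt y zero    q = linear alt (v y - c (suc q)) [] (map col (down q)) (λ _ → refl)
    gapCols-split G alt y (suc s) q =
      trans (gapCols-split (G ∘ (col (suc (s ℕ.+ suc q)) ∷_)) (cons _ alt) y s q)
            (cong (λ k → G (col k ∷ map col (gap (suc s) q)) + (v y - c (suc q)) * G (map col (gap (suc s) (suc q))))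
                  (cong suc (ℕₚ.+-suc s q)))

    det-gap : ∀ y xs s q → length xs ≡ s ℕ.+ suc q →
      det e (y ∷ xs) (gap (suc s) (suc q))
        ≡ differences y xs * (det e xs (gap (suc s) q) + (v y - c (suc q)) * det e xs (gap s (suc q)))
    det-gap y xs s q len = begin
      det e (y ∷ xs) (gap (suc s) (suc q))
        ≡⟨ det-col (y ∷ xs) (gap (suc s) (suc q)) ⟨
      det apply (y ∷ xs) (map col (gap (suc s) (suc q)))
        ≡⟨ det-reduce y xs (gapCols y s q) (col 0) (trans (length-gapCols y s q) (sym len)) (gap-⇝ y s q) ⟩
      differences y xs * (1ℤ * det apply xs (gapCols y s q))
        ≡⟨ cong (differences y xs *_) (trans (*-identityˡ _) (gapCols-split (det apply xs) (det-alternating xs) y s q)) ⟩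
      differences y xs * (det apply xs (map col (gap (suc s) q)) + k * det apply xs (map col (gap s (suc q))))
        ≡⟨ cong₂ (λ a b → differences y xs * (a + k * b)) (det-col xs (gap (suc s) q)) (det-col xs (gap s (suc q))) ⟩
      differences y xs * (det e xs (gap (suc s) q) + k * det e xs (gap s (suc q))) ∎
      where k = v y - c (suc q)

  -- Falling factorials of the odd numbers with one order skipped.

  module FallGap where
    open Gap +_ +_

    -- The coefficient of x^s in the Bessel polynomial of degree s + q. The multiplier in the last
    -- clause is `v y - c (suc q)` for the largest row y = 2(s + q) + 3.
    gapNumber : ℕ → ℕ → ℕ
    gapNumber zero    q       = 1
    gapNumber (suc s) zero    = suc (dbl s) ℕ.* gapNumber s 0
    gapNumber (suc s) (suc q) = gapNumber (suc s) q ℕ.+ (dbl s ℕ.+ suc (suc q)) ℕ.* gapNumber s (suc q)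

    length-odds : ∀ n → length (odds n) ≡ n
    length-odds n = trans (length-map (suc ∘ dbl) (down n)) (length-down n)

    det-fall-gap : ∀ s q → det fall (odds (s ℕ.+ q)) (gap s q) ≡ vandermonde (odds (s ℕ.+ q)) * + gapNumber s q
    det-fall-gap zero    q    =
      trans (cong (λ n → det fall (odds q) (down n)) (sym (length-odds q)))
            (trans (det-down (odds q)) (sym (*-identityʳ (vandermonde (odds q)))))
    det-fall-gap (suc s) zero = begin
      det fall (y ∷ xs) (gap (suc s) 0)
        ≡⟨ det-gap₀ y xs s (trans (length-odds (s ℕ.+ 0)) (ℕₚ.+-identityʳ s)) ⟩
      Δ * ((+ y - 0ℤ) * det fall xs (gap s 0))
        ≡⟨ cong (λ z → Δ * ((+ y - 0ℤ) * z)) (det-fall-gap s 0) ⟩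
      Δ * ((+ y - 0ℤ) * (vandermonde xs * + gapNumber s 0))
        ≡⟨ ring Δ (+ y) (vandermonde xs) (+ gapNumber s 0) ⟩
      Δ * vandermonde xs * (+ y * + gapNumber s 0)
        ≡⟨ cong (Δ * vandermonde xs *_) (sym (pos-* y (gapNumber s 0))) ⟩
      Δ * vandermonde xs * + (y ℕ.* gapNumber s 0)
        ≡⟨ cong (λ n → Δ * vandermonde xs * + (suc (dbl n) ℕ.* gapNumber s 0)) (ℕₚ.+-identityʳ s) ⟩
      Δ * vandermonde xs * + (suc (dbl s) ℕ.* gapNumber s 0) ∎
      where
      y  = suc (dbl (s ℕ.+ 0))
      xs = odds (s ℕ.+ 0)
      Δ  = differences y xs
      ring : ∀ d y v b → d * ((y - 0ℤ) * (v * b)) ≡ d * v * (y * b)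
      ring = solve-∀
    det-fall-gap (suc s) (suc q) = begin
      det fall (y ∷ xs) (gap (suc s) (suc q))
        ≡⟨ det-gap y xs s q (length-odds (s ℕ.+ suc q)) ⟩
      Δ * (det fall xs (gap (suc s) q) + (+ y - + suc q) * det fall xs (gap s (suc q)))
        ≡⟨ cong₂ (λ a b → Δ * (a + (+ y - + suc q) * b))
             (subst (λ n → det fall (odds n) (gap (suc s) q) ≡ vandermonde (odds n) * + gapNumber (suc s) q)
                    (sym (ℕₚ.+-suc s q)) (det-fall-gap (suc s) q))
             (det-fall-gap s (suc q)) ⟩
      Δ * (V * + b₁ + (+ y - + suc q) * (V * + b₂))
        ≡⟨ cong (λ z → Δ * (V * + b₁ + z * (V * + b₂))) κ≡ ⟩
      Δ * (V * + b₁ + + κ * (V * + b₂))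
        ≡⟨ ring₁ Δ V (+ b₁) (+ κ) (+ b₂) ⟩
      Δ * V * (+ b₁ + + κ * + b₂)
        ≡⟨ cong (λ z → Δ * V * (+ b₁ + z)) (sym (pos-* κ b₂)) ⟩
      Δ * V * (+ b₁ + + (κ ℕ.* b₂)) ∎
      where
      y  = suc (dbl (s ℕ.+ suc q))
      xs = odds (s ℕ.+ suc q)
      Δ  = differences y xs
      V  = vandermonde xs
      κ  = dbl s ℕ.+ suc (suc q)
      b₁ = gapNumber (suc s) q
      b₂ = gapNumber s (suc q)
      ring₁ : ∀ d v a k b → d * (v * a + k * (v * b)) ≡ d * v * (a + k * b)
      ring₁ = solve-∀
      ring₂ : ∀ a b → a + b - b ≡ a
      ring₂ = solve-∀
      ring₃ : ∀ s q → suc (s ℕ.+ suc q ℕ.+ (s ℕ.+ suc q)) ≡ s ℕ.+ s ℕ.+ suc (suc q) ℕ.+ suc q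
      ring₃ = ℕ-Solver.solve-∀
      κ≡ : + y - + suc q ≡ + κ
      κ≡ = trans (cong (λ n → + n - + suc q) (trans (cong suc (dbl≡ (s ℕ.+ suc q)))
             (trans (ring₃ s q) (cong (λ n → n ℕ.+ suc (suc q) ℕ.+ suc q) (sym (dbl≡ s))))))
           (trans (cong (_- + suc q) (pos-+ κ (suc q))) (ring₂ (+ κ) (+ suc q)))

    -- Free of division, this shows that `gapNumber s q` divides (2s + q)!. In the last case the two
    -- summands give q + 1 and 2(s + 1) copies of (2s + q + 2)!.
    gapNumber-closed : ∀ s q → gapNumber s q ℕ.* (2 ℕ.^ s ℕ.* (q ! ℕ.* s !)) ≡ (dbl s ℕ.+ q) !
    gapNumber-closed zero    q    = ring (q !)
      where
      ring : ∀ a → 1 ℕ.* (1 ℕ.* (a ℕ.* 1)) ≡ a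
      ring = ℕ-Solver.solve-∀
    gapNumber-closed (suc s) zero = begin
      suc (dbl s) ℕ.* b ℕ.* (2 ℕ.* 2 ℕ.^ s ℕ.* (1 ℕ.* (suc s ℕ.* s !)))
        ≡⟨ ring₁ (dbl s) s b (2 ℕ.^ s) (s !) ⟩
      suc s ℕ.* 2 ℕ.* (suc (dbl s) ℕ.* (b ℕ.* (2 ℕ.^ s ℕ.* (1 ℕ.* s !))))
        ≡⟨ cong₂ (λ m n → m ℕ.* (suc (dbl s) ℕ.* n)) two (gapNumber-closed s 0) ⟩
      suc (suc (dbl s)) ℕ.* (suc (dbl s) ℕ.* (dbl s ℕ.+ 0) !)
        ≡⟨ cong (λ n → suc (suc n) ℕ.* (suc n ℕ.* (dbl s ℕ.+ 0) !)) (ℕₚ.+-identityʳ (dbl s)) ⟨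
      suc (suc (dbl s ℕ.+ 0)) ! ∎
      where
      b = gapNumber s 0
      ring₁ : ∀ n s b t f → suc n ℕ.* b ℕ.* (2 ℕ.* t ℕ.* (1 ℕ.* (suc s ℕ.* f)))
              ≡ suc s ℕ.* 2 ℕ.* (suc n ℕ.* (b ℕ.* (t ℕ.* (1 ℕ.* f))))
      ring₁ = ℕ-Solver.solve-∀
      ring₂ : ∀ s → suc s ℕ.* 2 ≡ suc (suc (s ℕ.+ s))
      ring₂ = ℕ-Solver.solve-∀
      two : suc s ℕ.* 2 ≡ suc (suc (dbl s))
      two = trans (ring₂ s) (cong (suc ∘ suc) (sym (dbl≡ s)))
    gapNumber-closed (suc s) (suc q) = begin
      (b₁ ℕ.+ κ ℕ.* b₂) ℕ.* (2 ℕ.* t ℕ.* (suc q ℕ.* q ! ℕ.* (suc s ℕ.* s !)))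
        ≡⟨ ring₁ b₁ κ b₂ t (q !) (s !) q s ⟩
      suc q ℕ.* (b₁ ℕ.* (2 ℕ.* t ℕ.* (q ! ℕ.* (suc s ℕ.* s !))))
        ℕ.+ 2 ℕ.* suc s ℕ.* (κ ℕ.* (b₂ ℕ.* (t ℕ.* (suc q ℕ.* q ! ℕ.* s !))))
        ≡⟨ cong₂ (λ m n → suc q ℕ.* m ℕ.+ 2 ℕ.* suc s ℕ.* (κ ℕ.* n)) (gapNumber-closed (suc s) q) (gapNumber-closed s (suc q)) ⟩
      suc q ℕ.* suc (suc (dbl s ℕ.+ q)) ! ℕ.+ 2 ℕ.* suc s ℕ.* (κ ℕ.* (dbl s ℕ.+ suc q) !)
        ≡⟨ cong₂ (λ m n → suc q ℕ.* suc (suc (dbl s ℕ.+ q)) ! ℕ.+ 2 ℕ.* suc s ℕ.* (m ℕ.* n !)) κ≡ (ℕₚ.+-suc (dbl s) q) ⟩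
      suc q ℕ.* f ℕ.+ 2 ℕ.* suc s ℕ.* f
        ≡⟨ ring₂ q s f ⟩
      suc (suc (s ℕ.+ s ℕ.+ suc q)) ℕ.* f
        ≡⟨ cong₂ (λ m n → suc (suc (m ℕ.+ suc q)) ℕ.* suc n !) (sym (dbl≡ s)) (sym (ℕₚ.+-suc (dbl s) q)) ⟩
      suc (suc (dbl s ℕ.+ suc q)) ! ∎
      where
      b₁ = gapNumber (suc s) q
      b₂ = gapNumber s (suc q)
      κ  = dbl s ℕ.+ suc (suc q)
      t  = 2 ℕ.^ s
      f  = suc (suc (dbl s ℕ.+ q)) !
      κ≡ : κ ≡ suc (suc (dbl s ℕ.+ q))
      κ≡ = trans (ℕₚ.+-suc (dbl s) (suc q)) (cong suc (ℕₚ.+-suc (dbl s) q))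
      ring₁ : ∀ b₁ κ b₂ t f g q s → (b₁ ℕ.+ κ ℕ.* b₂) ℕ.* (2 ℕ.* t ℕ.* (suc q ℕ.* f ℕ.* (suc s ℕ.* g)))
              ≡ suc q ℕ.* (b₁ ℕ.* (2 ℕ.* t ℕ.* (f ℕ.* (suc s ℕ.* g))))
                ℕ.+ 2 ℕ.* suc s ℕ.* (κ ℕ.* (b₂ ℕ.* (t ℕ.* (suc q ℕ.* f ℕ.* g))))
      ring₁ = ℕ-Solver.solve-∀
      ring₂ : ∀ q s f → suc q ℕ.* f ℕ.+ 2 ℕ.* suc s ℕ.* f ≡ suc (suc (s ℕ.+ s ℕ.+ suc q)) ℕ.* f
      ring₂ = ℕ-Solver.solve-∀

-- Zero-sum free lists modulo a prime: the contradiction at the critical size.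

module ZeroSumFreeLists where

  open Determinants
  open SignedSums
  open ColumnOperations
  open import Data.Empty using (⊥)
  open import Data.Integer using (ℤ; +_; 0ℤ; 1ℤ; _+_; _*_; _-_; -_; ∣_∣)
  open import Data.Integer.Divisibility.Signed
  open import Data.Integer.DivMod using (_%ℕ_; _/ℕ_; n%ℕd<d; a≡a%ℕn+[a/ℕn]*n)
  open import Data.Integer.Properties using (abs-*; pos-+; ∣-i∣≡∣i∣; ⊖-≥; m-n≡m⊖n)
  open import Data.Integer.Tactic.RingSolver using (solve-∀)
  open import Data.List using (List; []; _∷_; map; length)
  open import Data.List.Properties using (length-map)
  open import Data.List.Relation.Binary.Sublist.Propositional using (_⊆_; []; _∷_; _∷ʳ_; from∈)
  open import Data.List.Relation.Unary.All as All using (All; []; _∷_)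
  open import Data.List.Relation.Unary.AllPairs as AllPairs using (AllPairs; []; _∷_)
  import Data.List.Relation.Unary.AllPairs.Properties as AllPairs
  import Data.List.Relation.Unary.All.Properties as All
  open import Data.Nat as ℕ using (ℕ; zero; suc; _≤_; _<_; z≤n; s≤s; _!)
  import Data.Nat.Divisibility as ℕ
  open import Data.Nat.ListAction using (sum)
  open import Data.Nat.Primality using (Prime; euclidsLemma; prime⇒nonTrivial)
  import Data.Nat.Properties as ℕₚ
  open import Data.Product using (∃; _×_; _,_)
  open import Data.Sum using (inj₁; inj₂)
  open import Function using (_∘_; id)
  open import Relation.Binary.PropositionalEquality
  open import Relation.Nullary using (¬_; contradiction)
  open ≡-Reasoning

  data Signed : List ℤ → List ℤ → Set where
    []  : Signed [] []
    pos : ∀ {a as xs} → Signed as xs → Signed (a ∷ as) (a ∷ xs)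
    neg : ∀ {a as xs} → Signed as xs → Signed (a ∷ as) (- a ∷ xs)

  signedSum-∣ : ∀ {k} as F → (∀ {xs} → Signed as xs → k ∣ F xs) → k ∣ signedSum as F
  signedSum-∣ []       F h = h []
  signedSum-∣ (a ∷ as) F h = ∣m∣n⇒∣m-n (signedSum-∣ as _ (h ∘ pos)) (signedSum-∣ as _ (h ∘ neg))

  -- Replacing every sign εᵢ by εᵢ + 1 ∈ {0, 2} turns a signed sum into twice a subset sum.
  signed-subset : ∀ ns {xs} → Signed (map +_ ns) xs →
    ∃ λ ys → ys ⊆ ns × sum-of id xs + sum-of id (map +_ ns) ≡ + sum ys + + sum ys
                     × (ys ≡ [] → xs ≡ map (-_) (map +_ ns))
  signed-subset []       [] = [] , [] , refl , λ _ → refl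
  signed-subset (n ∷ ns) {_ ∷ xs} (pos s) with signed-subset ns s
  ... | ys , ys⊆ , eq , _ = n ∷ ys , refl ∷ ys⊆ , sum-eq , λ ()
    where
    ring₁ : ∀ n a b → n + a + (n + b) ≡ n + n + (a + b)
    ring₁ = solve-∀
    ring₂ : ∀ n a → n + n + (a + a) ≡ n + a + (n + a)
    ring₂ = solve-∀
    sum-eq = trans (ring₁ (+ n) (sum-of id xs) (sum-of id (map +_ ns)))
      (trans (cong (_+_ (+ n + + n)) eq) (trans (ring₂ (+ n) (+ sum ys)) (cong₂ _+_ (sym (pos-+ n (sum ys))) (sym (pos-+ n (sum ys))))))
  signed-subset (n ∷ ns) {_ ∷ xs} (neg s) with signed-subset ns s
  ... | ys , ys⊆ , eq , all-neg = ys , n ∷ʳ ys⊆ , trans (ring (+ n) (sum-of id xs) (sum-of id (map +_ ns))) eq ,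
        λ ys≡[] → cong (- + n ∷_) (all-neg ys≡[])
    where
    ring : ∀ n a b → - n + a + (n + b) ≡ a + b
    ring = solve-∀

  module ModPrime (m : ℕ) (prime : Prime (suc m)) where

    private p = suc m

    p∤ : ℤ → Set
    p∤ z = ¬ + p ∣ z

    p∤-* : ∀ {x y} → p∤ x → p∤ y → p∤ (x * y)
    p∤-* {x} {y} p∤x p∤y p∣xy with euclidsLemma ∣ x ∣ ∣ y ∣ prime (subst (p ℕ.∣_) (abs-* x y) (∣⇒∣ᵤ p∣xy))
    ... | inj₁ p∣x = p∤x (∣ᵤ⇒∣ p∣x)
    ... | inj₂ p∣y = p∤y (∣ᵤ⇒∣ p∣y)

    p∤-neg : ∀ {x} → p∤ x → p∤ (- x)
    p∤-neg {x} p∤x p∣-x = p∤x (∣ᵤ⇒∣ (subst (p ℕ.∣_) (∣-i∣≡∣i∣ x) (∣⇒∣ᵤ p∣-x)))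

    p∤-pos : ∀ {n} → ¬ p ℕ.∣ n → p∤ (+ n)
    p∤-pos p∤n p∣n = p∤n (∣⇒∣ᵤ p∣n)

    p∤-small : ∀ {n} → 0 < n → n < p → ¬ p ℕ.∣ n
    p∤-small {suc n} _ n<p = ℕ.>⇒∤ n<p

    1<p : 1 < p
    1<p = ℕ.nonTrivial⇒n>1 p {{prime⇒nonTrivial prime}}

    p∤1 : p∤ 1ℤ
    p∤1 = p∤-pos (p∤-small (s≤s z≤n) 1<p)

    p∤-! : ∀ n → n < p → ¬ p ℕ.∣ n !
    p∤-! zero    _   = p∤-small (s≤s z≤n) 1<p
    p∤-! (suc n) n<p p∣ with euclidsLemma (suc n) (n !) prime p∣
    ... | inj₁ p∣n  = p∤-small (s≤s z≤n) n<p p∣n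
    ... | inj₂ p∣n! = p∤-! n (ℕₚ.<⇒≤ n<p) p∣n!

    p∤-sgn : ∀ n → p∤ (sgn n)
    p∤-sgn zero    = p∤1
    p∤-sgn (suc n) = p∤-neg (p∤-sgn n)

    p∤-product : ∀ {X : Set} {g : X → ℤ} {xs} → All (p∤ ∘ g) xs → p∤ (product-of g xs)
    p∤-product []       = p∤1
    p∤-product (h ∷ hs) = p∤-* h (p∤-product hs)

    p∤-vandermonde : ∀ {X : Set} (v : X → ℤ) c {xs} → AllPairs (λ y x → p∤ (v x - v y)) xs →
                     p∤ (Gap.vandermonde v c xs)
    p∤-vandermonde v c []                = p∤1
    p∤-vandermonde v c {_ ∷ xs} (h ∷ hs) = p∤-* (p∤-* (p∤-sgn (length xs)) (p∤-product h)) (p∤-vandermonde v c hs)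

    p∤-gapNumber : ∀ s q → dbl s ℕ.+ q < p → p∤ (+ FallGap.gapNumber s q)
    p∤-gapNumber s q lt = p∤-pos λ p∣b →
      p∤-! (dbl s ℕ.+ q) lt (subst (p ℕ.∣_) (FallGap.gapNumber-closed s q) (ℕ.∣m⇒∣m*n _ p∣b))

    p∤-difference : ∀ {x y} → x < y → y < p → p∤ (+ x - + y)
    p∤-difference {x} {y} x<y y<p p∣ = p∤-small {y ℕ.∸ x} (ℕₚ.m<n⇒0<n∸m x<y) (ℕₚ.≤-<-trans (ℕₚ.m∸n≤m y x) y<p)
      (∣⇒∣ᵤ (subst (+ p ∣_) eq (∣m⇒∣-m p∣)))
      where
      ring : ∀ x y → - (x - y) ≡ y - x
      ring = solve-∀
      eq : - (+ x - + y) ≡ + (y ℕ.∸ x)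
      eq = trans (ring (+ x) (+ y)) (trans (m-n≡m⊖n y x) (⊖-≥ (ℕₚ.<⇒≤ x<y)))

    p∤-odds : ∀ n → dbl n < p → p∤ (Gap.vandermonde +_ +_ (odds n))
    p∤-odds n lt = p∤-vandermonde +_ +_ (go n lt)
      where
      bounded : ∀ n → All (_< dbl n) (odds n)
      bounded zero    = []
      bounded (suc n) = ℕₚ.≤-refl ∷ All.map (λ r<n → ℕₚ.<-trans r<n (s≤s (ℕₚ.n≤1+n _))) (bounded n)
      go : ∀ n → dbl n < p → AllPairs (λ y x → p∤ (+ x - + y)) (odds n)
      go zero    _  = []
      go (suc n) lt = All.map (λ x<n → p∤-difference (ℕₚ.m<n⇒m<1+n x<n) (ℕₚ.<-trans ℕₚ.≤-refl lt)) (bounded n)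
                      ∷ go n (ℕₚ.<-trans (s≤s (ℕₚ.n≤1+n _)) lt)

    -- Here `suc s` stands for d(d + 1)/2 - (p - 1), positive at the critical size, and `q` for the
    -- rest of d. By `top`, the exponents of Δₛ and the p - 1 linear factors together have degree
    -- d².
    module _ (ns : List ℕ) (s q : ℕ) (len : length ns ≡ suc s ℕ.+ q) (2d<p : dbl (suc s ℕ.+ q) < p)
             (top : sum (gap (suc s) q) ℕ.+ m ≡ (suc s ℕ.+ q) ℕ.* (suc s ℕ.+ q))
             (zero-sum-free : ∀ {y ys} → y ∷ ys ⊆ ns → ¬ p ℕ.∣ sum (y ∷ ys))
             (distinct : AllPairs (λ a b → p∤ (+ b - + a)) ns) where

      private
        d = suc s ℕ.+ q
        as = map +_ ns
        σ = sum-of id as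
        K = gap (suc s) q

        τ : ℕ → ℤ
        -- Indices start at 0, so the factors subtract 1, ..., p - 1: one for each nonzero residue,
        -- none for 0.
        τ n = σ - + suc n

        open SignedAlternants as τ d

        V W : ℤ
        V = det pow (map (-_) as) (down d)
        W = det pow (map (-_) as) K

        p∤2 : p∤ (+ 2)
        p∤2 = p∤-pos (p∤-small (s≤s z≤n) (ℕₚ.≤-<-trans (s≤s (s≤s z≤n)) 2d<p))

        p∤-double : ∀ {x} → p∤ x → p∤ (x + x)
        p∤-double {x} p∤x = subst p∤ (ring x) (p∤-* p∤2 p∤x)
          where
          ring : ∀ x → + 2 * x ≡ x + x
          ring = solve-∀

        shifted-∣ : ∀ n {j} y → j < n → y + τ j ∣ shifted n y
        shifted-∣ (suc n) y j<n with ℕₚ.m≤n⇒m<n∨m≡n (ℕₚ.≤-pred j<n)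
        ... | inj₁ j<n′ = ∣n⇒∣m*n (y + τ n) (shifted-∣ n y j<n′)
        ... | inj₂ refl = ∣m⇒∣m*n (shifted n y) ∣-refl

        p∣shifted : ∀ y → p∤ (y + σ) → + p ∣ shifted m y
        p∣shifted y p∤y+σ with (y + σ) %ℕ p in eq | n%ℕd<d (y + σ) p | a≡a%ℕn+[a/ℕn]*n (y + σ) p
        ... | zero  | _       | y+σ≡ = contradiction (divides ((y + σ) /ℕ p) (trans y+σ≡ (ring (((y + σ) /ℕ p) * + p)))) p∤y+σ
          where
          ring : ∀ x → 0ℤ + x ≡ x
          ring = solve-∀
        ... | suc j | s≤s j<m | y+σ≡ = ∣-trans (divides ((y + σ) /ℕ p)
                (trans (ring₁ y σ (+ suc j)) (trans (cong (_- + suc j) y+σ≡) (ring₂ (+ suc j) (((y + σ) /ℕ p) * + p)))))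
                (shifted-∣ m y j<m)
          where
          ring₁ : ∀ y s j → y + (s - j) ≡ y + s - j
          ring₁ = solve-∀
          ring₂ : ∀ j x → j + x - j ≡ x
          ring₂ = solve-∀

        -- The coefficients make the two terms cancel at the all-negative pattern, the one that
        -- belongs to the empty subset and on which zero-sum freeness says nothing.
        test : List ℤ → ℤ
        test xs = V * (shifted m (sum-of id xs) * det pow xs K) + - W * (shifted m (sum-of id xs) * det pow xs (down d))

        p∣test : ∀ {xs} → Signed as xs → + p ∣ test xs
        p∣test {xs} sg with signed-subset ns sg
        ... | [] , _ , _ , all-neg rewrite all-neg refl = divides 0ℤ (ring V W (shifted m (sum-of id (map (-_) as))))
          where
          ring : ∀ v w f → v * (f * w) + - w * (f * v) ≡ 0ℤ
          ring = solve-∀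
        ... | y ∷ ys , ys⊆ , eq , _ =
          ∣m∣n⇒∣m+n (∣n⇒∣m*n V (∣m⇒∣m*n _ p∣f)) (∣n⇒∣m*n (- W) (∣m⇒∣m*n _ p∣f))
          where
          p∣f : + p ∣ shifted m (sum-of id xs)
          p∣f = p∣shifted (sum-of id xs) (subst p∤ (sym eq) (p∤-double (p∤-pos (zero-sum-free ys⊆))))

        -- The exponent sum of `down d` is `suc s` less than that of `K`, hence below top degree.
        S-down : S m (down d) ≡ 0ℤ
        S-down = S-small m (gap-desc 0 d) (length-down d)
          (subst (sum (down d) ℕ.+ m <_) top (ℕₚ.+-monoˡ-< m
            (subst (sum (down d) <_) (sym (sum-gap (suc s) q)) (ℕₚ.m<n+m (sum (down d)) {suc s} (s≤s z≤n)))))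

        p∣VS : + p ∣ V * S m K
        p∣VS = subst (+ p ∣_) eq (signedSum-∣ as test p∣test)
          where
          ring : ∀ a b → a + b * 0ℤ ≡ a
          ring = solve-∀
          eq : signedSum as test ≡ V * S m K
          eq = trans (signedSum-linear as V (- W) (λ xs → shifted m (sum-of id xs) * det pow xs K)
                                                  (λ xs → shifted m (sum-of id xs) * det pow xs (down d)))
               (trans (cong (λ z → V * S m K + - W * z) S-down) (ring (V * S m K) (- W)))

        p∤-det-down : ∀ {xs} → length xs ≡ d → AllPairs (λ y x → p∤ (x - y)) xs → p∤ (det pow xs (down d))
        p∤-det-down {xs} eq h = subst p∤ (trans (sym (Gap.det-down id (λ _ → 0ℤ) xs)) (cong (det pow xs ∘ down) eq))
          (p∤-vandermonde id (λ _ → 0ℤ) h)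

        len-as : length as ≡ d
        len-as = trans (length-map +_ ns) len

        p∤V : p∤ V
        p∤V = p∤-det-down (trans (length-map (-_) as) len-as)
          (AllPairs.map⁺ (AllPairs.map⁺ (AllPairs.map (λ {a} {b} h → subst p∤ (ring (+ a) (+ b)) (p∤-neg h)) distinct)))
          where
          ring : ∀ a b → - (b - a) ≡ - b - - a
          ring = solve-∀

        nonzero : All (p∤ ∘ +_) ns
        nonzero = All.tabulate λ {n} n∈ns → p∤-pos
          (subst (¬_ ∘ (p ℕ.∣_)) (ℕₚ.+-identityʳ n) (zero-sum-free (from∈ n∈ns)))

        -- b² - a² = (b - a)(a + b), and a + b is the sum of a two-element sublist.
        p∤-squares : ∀ {ns} → (∀ {y ys} → y ∷ ys ⊆ ns → ¬ p ℕ.∣ sum (y ∷ ys)) →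
          AllPairs (λ a b → p∤ (+ b - + a)) ns → AllPairs (λ a b → p∤ (+ b * + b - + a * + a)) ns
        p∤-squares zsf [] = []
        p∤-squares {n ∷ ns} zsf (h ∷ hs) = All.tabulate square ∷ p∤-squares (λ ⊆ns → zsf (n ∷ʳ ⊆ns)) hs
          where
          ring₁ : ∀ a b → (b - a) * (a + b) ≡ b * b - a * a
          ring₁ = solve-∀
          square : ∀ {b} → _ → p∤ (+ b * + b - + n * + n)
          square {b} b∈ = subst p∤ (ring₁ (+ n) (+ b)) (p∤-* (All.lookup h b∈)
            (subst p∤ (pos-+ n b) (p∤-pos (subst (¬_ ∘ (p ℕ.∣_)) (cong (n ℕ.+_) (ℕₚ.+-identityʳ b)) (zsf (refl ∷ from∈ b∈))))))

        -- Each row releases a factor 2a, and a Vandermonde determinant in the squares remains.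
        p∤S₀ : p∤ (S 0 (odds d))
        p∤S₀ = subst p∤ (sym (trans (S-zero (odds d))
            (det-scaleRows oddPart pow (λ a → a + a) (λ a → a * a) (suc ∘ dbl) oddPart-odd as (down d))))
          (p∤-* (p∤-product (All.map⁺ (All.map (λ h → p∤-double h) nonzero)))
                (p∤-det-down (trans (length-map _ as) len-as)
                  (AllPairs.map⁺ (AllPairs.map⁺ (p∤-squares zero-sum-free distinct)))))

        -- `D K` is made of differences of odd numbers below 2d and a divisor of the factorial of
        -- `dbl (suc s) + q`, which is at most 2d < p.
        p∤D : p∤ (D K)
        p∤D = subst p∤ (sym (FallGap.det-fall-gap (suc s) q)) (p∤-* (p∤-odds d 2d<p) (p∤-gapNumber (suc s) q
          (ℕₚ.≤-<-trans (s≤s (s≤s le)) 2d<p)))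
          where
          le : dbl s ℕ.+ q ≤ dbl (s ℕ.+ q)
          le = subst₂ _≤_ (cong (ℕ._+ q) (sym (dbl≡ s))) (sym (dbl≡ (s ℕ.+ q)))
            (subst (_≤ s ℕ.+ q ℕ.+ (s ℕ.+ q)) (trans (ℕₚ.+-assoc s q s) (trans (cong (s ℕ.+_) (ℕₚ.+-comm q s)) (sym (ℕₚ.+-assoc s s q))))
              (ℕₚ.+-monoʳ-≤ (s ℕ.+ q) (ℕₚ.m≤m+n s q)))

      -- Multiplying `p∣VS` by `D (odds d)` and applying `S-top` makes p divide the product of `V`,
      -- (p - 1)!, `D K` and `S 0 (odds d)`, none of which it divides.
      no-zero-sum-free : ⊥
      no-zero-sum-free = p∤-* p∤V (p∤-* (p∤-pos (p∤-! m ℕₚ.≤-refl)) (p∤-* p∤D p∤S₀)) (subst (+ p ∣_)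
        (trans (ring (D (odds d)) V (S m K)) (cong (V *_) (S-top m (gap-desc (suc s) q) (length-gap (suc s) q) top)))
        (∣n⇒∣m*n (D (odds d)) p∣VS))
        where
        ring : ∀ a b c → a * (b * c) ≡ b * (a * c)
        ring = solve-∀

open SignedSums using (dbl; dbl≡; down; even⊎odd; sum-down)
open ColumnOperations using (gap; sum-gap)
open ZeroSumFreeLists

open import Defs
open import Data.Empty using (⊥-elim)
open import Data.Fin using (Fin; zero; suc; toℕ; fromℕ<)
open import Data.Fin.Properties using (injective⇒≤; toℕ-fromℕ<)
open import Data.Fin.Subset using (Subset; inside; outside; Nonempty; ∣_∣) renaming (_⊆_ to _⊆ˢ_)
open import Data.Fin.Subset.Properties using (out⊆; in⊆in; drop-∷-⊆)
import Data.Integer as ℤ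
open import Data.Integer.Tactic.RingSolver using () renaming (solve-∀ to ℤ-solve-∀)
open import Data.List as List using (List; []; _∷_; length; map; take)
open import Data.List.Membership.Propositional.Properties using (∈-lookup)
open import Data.List.Properties using (length-map; length-take)
open import Data.List.Relation.Binary.Sublist.Propositional using (_⊆_; []; _∷_; _∷ʳ_; from∈; ⊆-trans)
open import Data.List.Relation.Binary.Sublist.Propositional.Properties using (take-⊆)
open import Data.List.Relation.Unary.All as All using (All; []; _∷_)
import Data.List.Relation.Unary.All.Properties as All
open import Data.List.Relation.Unary.AllPairs as AllPairs using (AllPairs; []; _∷_)
import Data.List.Relation.Unary.AllPairs.Properties as AllPairs
open import Data.List.Relation.Unary.Unique.Propositional using (Unique)
open import Data.Nat
open import Data.Nat.Divisibility using (_∣_; divides; ∣-refl; n∣m⇒m%n≡0)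
open import Data.Nat.DivMod using (m<n⇒m%n≡m; m*n/n≡m)
open import Data.Nat.ListAction using (sum)
open import Data.Nat.Primality using (Prime; prime⇒irreducible)
open import Data.Nat.Properties
open import Data.Nat.Tactic.RingSolver using (solve-∀)
open import Data.Product using (∃; _×_; _,_; proj₁; proj₂)
open import Data.Sum using (_⊎_; inj₁; inj₂)
open import Data.Vec using (Vec; []; _∷_; tabulate; here; there; replicate) renaming (_++_ to _++ᵛ_)
open import Relation.Binary.PropositionalEquality
open import Relation.Nullary using (¬_; contradiction; yes; no)

-- Subsets of residues as increasing lists of naturals.

select : ∀ {n} → Subset n → Vec ℕ n → List ℕ
select []            []      = []
select (outside ∷ I) (_ ∷ v) = select I v
select (inside ∷ I)  (x ∷ v) = x ∷ select I v

-- The local function of sumℕ cannot be named here: the underscore in the type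
-- of go-select is solved to it by the calls in sumℕ-select.
mutual
  sumℕ-select : ∀ {n} (I : Subset n) → sumℕ I ≡ sum (select I (tabulate toℕ))
  sumℕ-select {n} I with tabulate {n = n} toℕ
  sumℕ-select {zero}  []            | []    = refl
  sumℕ-select {suc n} (outside ∷ I) | _ ∷ v with suc n | outside ∷ I
  ... | _ | J = go-select J I v
  sumℕ-select {suc n} (inside ∷ I)  | x ∷ v with suc n | inside ∷ I
  ... | _ | J = cong (x +_) (go-select J I v)

  go-select : ∀ {n} (J : Subset n) {m} (I : Subset m) (v : Vec ℕ m) → _ ≡ sum (select I v)
  go-select J []            []      = refl
  go-select J (outside ∷ I) (x ∷ v) = go-select J I v
  go-select J (inside ∷ I)  (x ∷ v) = cong (x +_) (go-select J I v)

-- The offset `o` is the number that the first position stands for.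
elements : ∀ {n} → ℕ → Subset n → List ℕ
elements o []            = []
elements o (outside ∷ I) = elements (suc o) I
elements o (inside ∷ I)  = o ∷ elements (suc o) I

select-elements : ∀ {n} (I : Subset n) o {f : Fin n → ℕ} → (∀ i → f i ≡ o + toℕ i) →
                  select I (tabulate f) ≡ elements o I
select-elements []            o eq = refl
select-elements (outside ∷ I) o eq = select-elements I (suc o) (λ i → trans (eq (suc i)) (+-suc o (toℕ i)))
select-elements (inside ∷ I)  o eq = cong₂ _∷_ (trans (eq zero) (+-identityʳ o))
  (select-elements I (suc o) (λ i → trans (eq (suc i)) (+-suc o (toℕ i))))

sumℕ-elements : ∀ {n} (I : Subset n) → sumℕ I ≡ sum (elements 0 I)
sumℕ-elements I = trans (sumℕ-select I) (cong sum (select-elements I 0 (λ _ → refl)))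

length-elements : ∀ {n} o (I : Subset n) → length (elements o I) ≡ ∣ I ∣
length-elements o []            = refl
length-elements o (outside ∷ I) = length-elements (suc o) I
length-elements o (inside ∷ I)  = cong suc (length-elements (suc o) I)

elements-≥ : ∀ {n} o (I : Subset n) → All (o ≤_) (elements o I)
elements-≥ o []            = []
elements-≥ o (outside ∷ I) = All.map <⇒≤ (elements-≥ (suc o) I)
elements-≥ o (inside ∷ I)  = ≤-refl ∷ All.map <⇒≤ (elements-≥ (suc o) I)

elements-< : ∀ {n} o (I : Subset n) → All (_< o + n) (elements o I)
elements-< o []                    = []
elements-< {suc n} o (outside ∷ I) rewrite +-suc o n = elements-< (suc o) I
elements-< {suc n} o (inside ∷ I)  rewrite +-suc o n = s≤s (m≤m+n o n) ∷ elements-< (suc o) I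

elements-increasing : ∀ {n} o (I : Subset n) → AllPairs _<_ (elements o I)
elements-increasing o []            = []
elements-increasing o (outside ∷ I) = elements-increasing (suc o) I
elements-increasing o (inside ∷ I)  = elements-≥ (suc o) I ∷ elements-increasing (suc o) I

sublist-subset : ∀ {n} o (A : Subset n) {ys} → ys ⊆ elements o A → ∃ λ I → I ⊆ˢ A × elements o I ≡ ys
sublist-subset o []            []            = [] , (λ ()) , refl
sublist-subset o (outside ∷ A) ys⊆           with sublist-subset (suc o) A ys⊆
... | I , I⊆A , eq = outside ∷ I , out⊆ I⊆A , eq
sublist-subset o (inside ∷ A)  (_ ∷ʳ ys⊆)    with sublist-subset (suc o) A ys⊆
... | I , I⊆A , eq = outside ∷ I , out⊆ I⊆A , eq
sublist-subset o (inside ∷ A)  (refl ∷ ys⊆)  with sublist-subset (suc o) A ys⊆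
... | I , I⊆A , eq = inside ∷ I , in⊆in I⊆A , cong (o ∷_) eq

elements-nonempty : ∀ {n} o (I : Subset n) {y ys} → elements o I ≡ y ∷ ys → Nonempty I
elements-nonempty o (outside ∷ I) eq with elements-nonempty (suc o) I eq
... | i , i∈I = suc i , there i∈I
elements-nonempty o (inside ∷ I)  eq = zero , here

elements-mono : ∀ {n} o (I B : Subset n) → I ⊆ˢ B → sum (elements o I) ≤ sum (elements o B)
elements-mono o []            []            _   = z≤n
elements-mono o (outside ∷ I) (outside ∷ B) I⊆B = elements-mono (suc o) I B (drop-∷-⊆ I⊆B)
elements-mono o (outside ∷ I) (inside ∷ B)  I⊆B = m≤n⇒m≤o+n o (elements-mono (suc o) I B (drop-∷-⊆ I⊆B))
elements-mono o (inside ∷ I)  (outside ∷ B) I⊆B with () ← I⊆B here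
elements-mono o (inside ∷ I)  (inside ∷ B)  I⊆B = +-monoʳ-≤ o (elements-mono (suc o) I B (drop-∷-⊆ I⊆B))

elements-positive : ∀ {n} o (I : Subset n) → Nonempty I → 0 < sum (elements (suc o) I)
elements-positive o (inside ∷ I)  _                   = s≤s z≤n
elements-positive o (outside ∷ I) (suc i , there i∈I) = elements-positive (suc o) I (i , i∈I)

-- Initial segments

triangle : ℕ → ℕ
triangle k = sum (down (suc k))

triangle-/ : ∀ k → k * (k + 1) / 2 ≡ triangle k
triangle-/ k = trans (cong (_/ 2) (trans (ring₁ k) (trans (cong (_+ k) (sym (sum-down k))) (ring₂ k (sum (down k))))))
                     (m*n/n≡m (triangle k) 2)
  where
  ring₁ : ∀ k → k * (k + 1) ≡ k * k + k
  ring₁ = solve-∀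
  ring₂ : ∀ k s → k + (s + s) + k ≡ (k + s) * 2
  ring₂ = solve-∀

initial : ∀ k r → Subset (k + r)
initial k r = replicate k inside ++ᵛ replicate r outside

∣initial∣ : ∀ k r → ∣ initial k r ∣ ≡ k
∣initial∣ zero    zero    = refl
∣initial∣ zero    (suc r) = ∣initial∣ zero r
∣initial∣ (suc k) r       = cong suc (∣initial∣ k r)

sum-initial : ∀ o k r → sum (elements o (initial k r)) ≡ k * o + sum (down k)
sum-initial o zero    zero    = refl
sum-initial o zero    (suc r) = sum-initial (suc o) zero r
sum-initial o (suc k) r       = trans (cong (_+_ o) (sum-initial (suc o) k r)) (ring o k (sum (down k)))
  where
  ring : ∀ o k s → o + (k * suc o + s) ≡ o + k * o + (k + s)
  ring = solve-∀

-- The leading `outside` skips the residue 0, so the set is {1, ..., k}. Its nonempty sums are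
-- positive and at most `triangle k`, hence unchanged by reduction modulo p.
initial-zeroSumFree : ∀ k r → triangle k < suc (k + r) → ZeroSumFree (outside ∷ initial k r)
initial-zeroSumFree k r lt (inside ∷ I , I⊆ , _ , _) with () ← I⊆ here
initial-zeroSumFree k r lt (outside ∷ I , I⊆ , (suc i , there i∈I) , eq) =
  <⇒≢ (elements-positive 0 I (i , i∈I)) (sym (trans (sym sum≡) (trans (sym (m<n⇒m%n≡m sum<)) eq)))
  where
  sum≡ : sumℕ (outside ∷ I) ≡ sum (elements 1 I)
  sum≡ = sumℕ-elements (outside ∷ I)
  sum< : sumℕ (outside ∷ I) < suc (k + r)
  sum< = ≤-<-trans (subst₂ _≤_ (sym sum≡) (trans (sum-initial 1 k r) (cong (_+ sum (down k)) (*-identityʳ k)))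
    (elements-mono 1 I (initial k r) (drop-∷-⊆ I⊆))) lt

-- Pigeonhole: positions inject into `Fin n` through their entries.
unique-bounded : ∀ {n xs} → Unique xs → All (_< n) xs → length xs ≤ n
unique-bounded {n} {xs} uniq bnd = injective⇒≤ {f = f} f-injective
  where
  f : Fin (length xs) → Fin n
  f i = fromℕ< (All.lookup bnd (∈-lookup i))
  lookup-injective : ∀ {xs : List ℕ} → Unique xs → ∀ i j → List.lookup xs i ≡ List.lookup xs j → i ≡ j
  lookup-injective (_ ∷ _)  zero    zero    _  = refl
  lookup-injective (x≢ ∷ _) zero    (suc j) eq = contradiction eq (All.lookup x≢ (∈-lookup j))
  lookup-injective (x≢ ∷ _) (suc i) zero    eq = contradiction (sym eq) (All.lookup x≢ (∈-lookup i))
  lookup-injective (_ ∷ u)  (suc i) (suc j) eq = cong suc (lookup-injective u i j eq)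
  f-injective : ∀ {i j} → f i ≡ f j → i ≡ j
  f-injective {i} {j} eq = lookup-injective uniq i j (trans (sym (toℕ-fromℕ< _)) (trans (cong toℕ eq) (toℕ-fromℕ< _)))

-- Folding n to the smaller of n and p − n is injective on a zero-sum free set.
module _ {p h : ℕ} (p≤ : p ≤ suc (dbl h)) where

  fold : ℕ → ℕ
  fold n with n ≤? h
  ... | yes _ = n
  ... | no  _ = p ∸ n

  fold-≤ : ∀ n → fold n < suc h
  fold-≤ n with n ≤? h
  ... | yes n≤h = s≤s n≤h
  ... | no  n≰h = s≤s (m≤n+o⇒m∸n≤o p n (≤-trans p≤ (≤-trans (s≤s (≤-reflexive (dbl≡ h))) (+-monoˡ-≤ h (≰⇒> n≰h)))))

  fold-positive : ∀ {n} → 0 < n → n < p → 0 < fold n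
  fold-positive {n} 0<n n<p with n ≤? h
  ... | yes _ = 0<n
  ... | no  _ = m<n⇒0<n∸m n<p

  fold-≡ : ∀ {a b} → a < p → b < p → fold a ≡ fold b → a ≡ b ⊎ a + b ≡ p
  fold-≡ {a} {b} a<p b<p eq with a ≤? h | b ≤? h
  ... | yes _ | yes _ = inj₁ eq
  ... | yes _ | no  _ = inj₂ (trans (cong (_+ b) eq) (m∸n+n≡m (<⇒≤ b<p)))
  ... | no  _ | yes _ = inj₂ (trans (cong (a +_) (sym eq)) (m+[n∸m]≡n (<⇒≤ a<p)))
  ... | no  _ | no  _ = inj₁ (∸-cancelˡ-≡ (<⇒≤ a<p) (<⇒≤ b<p) eq)

  -- The folded values are distinct, since a + b = p would be a zero sum, and lie in 1, ..., h.
  -- Adding 0 to them makes the pigeonhole bound `suc h` give h.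
  half-bound : ∀ {ns} → AllPairs _<_ ns → All (_< p) ns → (∀ {y ys} → y ∷ ys ⊆ ns → ¬ p ∣ sum (y ∷ ys)) →
               length ns ≤ h
  half-bound {ns} inc bnd zsf = ≤-pred (subst (λ n → suc n ≤ suc h) (length-map fold ns)
    (unique-bounded (All.map⁺ (All.map (λ 0<f 0≡f → <⇒≢ 0<f 0≡f) (positive bnd zsf)) ∷ AllPairs.map⁺ (unique inc bnd zsf))
                    (s≤s z≤n ∷ All.map⁺ (All.universal fold-≤ ns))))
    where
    positive : ∀ {ns} → All (_< p) ns → (∀ {y ys} → y ∷ ys ⊆ ns → ¬ p ∣ sum (y ∷ ys)) → All (λ n → 0 < fold n) ns
    positive bnd zsf = All.tabulate λ {n} n∈ → fold-positive (n≢0⇒n>0 (λ { refl → zsf (from∈ n∈) (divides 0 refl) })) (All.lookup bnd n∈)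
    unique : ∀ {ns} → AllPairs _<_ ns → All (_< p) ns → (∀ {y ys} → y ∷ ys ⊆ ns → ¬ p ∣ sum (y ∷ ys)) →
             AllPairs (λ a b → fold a ≢ fold b) ns
    unique []         []         zsf = []
    unique {a ∷ ns} (a< ∷ inc) (a<p ∷ bnd) zsf = All.tabulate distinct ∷ unique inc bnd (λ s → zsf (a ∷ʳ s))
      where
      distinct : ∀ {b} → _ → fold a ≢ fold b
      distinct {b} b∈ eq with fold-≡ a<p (All.lookup bnd b∈) eq
      ... | inj₁ a≡b = <⇒≢ (All.lookup a< b∈) a≡b
      ... | inj₂ a+b = zsf (refl ∷ from∈ b∈) (subst (p ∣_) (trans (sym a+b) (cong (a +_) (sym (+-identityʳ b)))) ∣-refl)

-- The upper bound through the critical size d, and the theorem.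

critical-size : ∀ {p} → 0 < p → ∀ k → p ≤ triangle k → ∃ λ d → d ≤ k × sum (down d) < p × p ≤ triangle d
critical-size 0<p zero    p≤ = contradiction p≤ (<⇒≱ 0<p)
critical-size {p} 0<p (suc k) p≤ with triangle k <? p
... | yes lt = suc k , ≤-refl , lt , p≤
... | no  ≮p with critical-size 0<p k (≮⇒≥ ≮p)
...   | d , d≤k , lt , le = d , m≤n⇒m≤1+n d≤k , lt , le

-- Zero-sum freeness passes to subsets, so a set that is too large can be cut down to its d smallest
-- elements, which `no-zero-sum-free` excludes.
triangle-bound : ∀ m → Prime (suc m) → (A : Subset (suc m)) → ZeroSumFree A → triangle ∣ A ∣ < suc m
triangle-bound m pr A zsf with triangle ∣ A ∣ <? suc m
... | yes lt = lt
... | no  ≮p with critical-size (s≤s z≤n) ∣ A ∣ (≮⇒≥ ≮p)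
...   | d , d≤∣A∣ , down<p , p≤tri = ⊥-elim
          (no-zero-sum-free ns s q (trans len d≡) (subst (λ n → dbl n < p) d≡ 2d<p) top free
            (AllPairs.map (λ {a} {b} h → subst p∤ (ring (ℤ.+ a) (ℤ.+ b)) (p∤-neg h)) (differences bounded increasing)))
  where
  open ModPrime m pr
  p = suc m
  ns = take d (elements 0 A)
  ring : ∀ a b → ℤ.- (a ℤ.- b) ≡ b ℤ.- a
  ring = ℤ-solve-∀

  len : length ns ≡ d
  len = trans (length-take d (elements 0 A)) (m≤n⇒m⊓n≡m (subst (d ≤_) (sym (length-elements 0 A)) d≤∣A∣))

  free : ∀ {y ys} → y ∷ ys ⊆ ns → ¬ p ∣ sum (y ∷ ys)
  free ys⊆ p∣ with sublist-subset 0 A (⊆-trans ys⊆ (take-⊆ d (elements 0 A)))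
  ... | I , I⊆A , eq = zsf (I , I⊆A , elements-nonempty 0 I eq ,
          n∣m⇒m%n≡0 _ p (subst (p ∣_) (sym (trans (sumℕ-elements I) (cong sum eq))) p∣))

  bounded : All (_< p) ns
  bounded = All.take⁺ d (elements-< 0 A)

  increasing : AllPairs _<_ ns
  increasing = AllPairs.take⁺ d (elements-increasing 0 A)

  differences : ∀ {ns} → All (_< p) ns → AllPairs _<_ ns → AllPairs (λ a b → p∤ (ℤ.+ a ℤ.- ℤ.+ b)) ns
  differences []         []         = []
  differences (_ ∷ bnd) (a< ∷ inc) =
    All.zipWith (λ (b<p , a<b) → p∤-difference a<b b<p) (bnd , a<) ∷ differences bnd inc

  2d<p : dbl d < p
  2d<p with even⊎odd p
  ... | inj₂ (h , p≡) = ≤-<-trans (dbl-mono (subst (_≤ h) len (half-bound {h = h} (≤-reflexive p≡) increasing bounded free)))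
                                  (≤-reflexive (sym p≡))
    where
    dbl-mono : ∀ {i j} → i ≤ j → dbl i ≤ dbl j
    dbl-mono z≤n       = z≤n
    dbl-mono (s≤s i≤j) = s≤s (s≤s (dbl-mono i≤j))
  -- An even prime is 2. Then h = 1, so d ≤ 1 and `triangle d` < 2, against p ≤ `triangle d`.
  ... | inj₁ (h , p≡) with prime⇒irreducible pr (divides h (trans p≡ (trans (dbl≡ h) (double h))))
    where
    double : ∀ h → h + h ≡ h * 2
    double = solve-∀
  ...   | inj₂ 2≡p = contradiction p≤tri (<⇒≱ (subst (triangle d <_) 2≡p (small d h
            (subst (_≤ h) len (half-bound {h = h} (≤-trans (≤-reflexive p≡) (n≤1+n _)) increasing bounded free))
            (trans (sym p≡) (sym 2≡p)))))
    where
    small : ∀ d h → d ≤ h → dbl h ≡ 2 → triangle d < 2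
    small zero       (suc zero) _        _ = s≤s z≤n
    small (suc zero) (suc zero) _        _ = ≤-refl
    small (suc (suc d)) (suc zero) (s≤s ()) _

  excess : ∃ λ s → suc s + m ≡ triangle d
  excess = triangle d ∸ p , trans (sym (+-suc (triangle d ∸ p) m)) (m∸n+n≡m p≤tri)

  s = proj₁ excess

  s<d : suc s ≤ d
  -- `triangle d` is d plus `sum (down d)`, and the latter is at most m = p - 1.
  s<d = +-cancelʳ-≤ m (suc s) d (≤-trans (≤-reflexive (proj₂ excess)) (+-monoʳ-≤ d (≤-pred down<p)))

  q = d ∸ suc s

  d≡ : d ≡ suc s + q
  d≡ = sym (m+[n∸m]≡n s<d)

  -- The total is d(d + 1)/2 + d(d - 1)/2, the first summand being `suc s + m`.
  top : sum (gap (suc s) q) + m ≡ (suc s + q) * (suc s + q)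
  top = begin
    sum (gap (suc s) q) + m              ≡⟨ cong (_+ m) (sum-gap (suc s) q) ⟩
    suc s + sum (down (suc s + q)) + m   ≡⟨ cong (λ n → suc s + sum (down n) + m) (sym d≡) ⟩
    suc s + sum (down d) + m             ≡⟨ ring₁ (suc s) (sum (down d)) m ⟩
    suc s + m + sum (down d)             ≡⟨ cong (_+ sum (down d)) (proj₂ excess) ⟩
    d + sum (down d) + sum (down d)      ≡⟨ +-assoc d (sum (down d)) (sum (down d)) ⟩
    d + (sum (down d) + sum (down d))    ≡⟨ sum-down d ⟩
    d * d                                ≡⟨ cong₂ _*_ d≡ d≡ ⟩
    (suc s + q) * (suc s + q)            ∎
    where
    open ≡-Reasoning
    ring₁ : ∀ a b c → a + b + c ≡ a + c + b
    ring₁ = solve-∀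

k≤triangle : ∀ k → k ≤ triangle k
k≤triangle k = m≤m+n k (sum (down k))

theorem9 : (p : ℕ) .{{_ : NonZero p}} → Prime p → (A : Subset p)
    → ZeroSumFree A
    → ((B : Subset p) → ZeroSumFree B → ∣ B ∣ ≤ ∣ A ∣)
    → ((∣ A ∣ * (∣ A ∣ + 1)) / 2 < p)
    × ((k : ℕ) → (k * (k + 1)) / 2 < p → k ≤ ∣ A ∣)
theorem9 (suc m) pr A zsf maximal =
  subst (_< suc m) (sym (triangle-/ ∣ A ∣)) (triangle-bound m pr A zsf) , lower
  where
  lower : (k : ℕ) → (k * (k + 1)) / 2 < suc m → k ≤ ∣ A ∣
  -- k ≤ `triangle k` ≤ m leaves room for 1, ..., k among the m nonzero residues.
  lower k lt = segment (m ∸ k) (m+[n∸m]≡n (≤-trans (k≤triangle k) (≤-pred tri<)))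
    where
    tri< : triangle k < suc m
    tri< = subst (_< suc m) (triangle-/ k) lt
    segment : ∀ r → k + r ≡ m → k ≤ ∣ A ∣
    -- Matching on `refl` makes the modulus `suc (k + r)`, so that {1, ..., k} can be compared with
    -- `A`.
    segment r refl = subst (_≤ ∣ A ∣) (∣initial∣ k r)
      (maximal (outside ∷ initial k r) (initial-zeroSumFree k r tri<))
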